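{- Let $q$ be any prime power and $n$ a positive integer. Let $\mathcal{W}=\{(x_1,\ldots,x_{n+1})\in\mathrm{GF}(q^2)^{n+1} : x_{n+1}=1\}$ and $\mathcal{W}_0=\{(x_1,\ldots,x_{n+1})\in\mathcal{W} : x_n\in C\}$, with $C$, $\mathcal{R}$ and the Hermitian forms $F^g$ ($g\in\mathcal{R}$) as defined in the context. Then the matrix $\mathcal{A}_0=A(F^g, g\in\mathcal{R};\mathcal{W}_0)$, whose rows are indexed by $g\in\mathcal{R}$, whose columns are indexed by $x\in\mathcal{W}_0$, and whose $(g,x)$ entry is $F^g(x)\in\mathrm{GF}(q)$, is a simple orthogonal array $OA(q^{2n-1},q^{2n-2},q,2)$ of index $\mu=q^{2n-3}$.
   Context: Orthogonal arrays: let $\mathcal{Q}$ be a set of $q$ symbols (here $\mathcal{Q}=\mathrm{GF}(q)$). A $k\times N$ matrix with entries in $\mathcal{Q}$ is an orthogonal array $OA(N,k,q,t)$ (with $q$ levels and strength $t$) if every $t\times N$ subarray (obtained by choosing $t$ distinct rows) contains each $t\times 1$ column with entries in $\mathcal{Q}$ exactly $\mu=N/q^t$ times; $\mu$ is called the index of the array. An orthogonal array is simple if it contains no repeated column. Array from functions: given functions $f_1,\ldots,f_k$ on a common finite domain $\mathcal{W}$, $A(f_1,\ldots,f_k;\mathcal{W})$ is the $k\times|\mathcal{W}|$ matrix whose columns are $(f_1(x),\ldots,f_k(x))^T$, $x\in\mathcal{W}$, in an arbitrary order (one column for each $x\in\mathcal{W}$, repetitions kept). Trace: $\mathrm{tr}:\mathrm{GF}(q^2)\to\mathrm{GF}(q)$,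 $\mathrm{tr}(x)=x^q+x$, and $T_0=\{t\in\mathrm{GF}(q^2):\mathrm{tr}(t)=0\}$. Let $C=\{a_1=0,a_2,\ldots,a_q\}$ be a fixed system of representatives for the cosets of the additive subgroup $T_0$ in $\mathrm{GF}(q^2)$. The set $\mathcal{R}$: it is the set of collineations $g$ of $PG(n,q^2)$ given, up to a non-zero scalar, by $(X'_1,\ldots,X'_{n+1})=(X_1,\ldots,X_{n+1})D_g^{ -1}$, where $D_g$ is the $(n+1)\times(n+1)$ matrix whose first $n$ rows are the first $n$ rows of the identity matrix and whose last row is $(i_1,i_2,\ldots,i_{n-1},i_n,1)$; here $(i_1,\ldots,i_{n-1})$ ranges over all of $\mathrm{GF}(q^2)^{n-1}$ and, for each such tuple, $i_n$ is the unique element of $C$ satisfying $i_1^{q+1}+\cdots+i_{n-1}^{q+1}+i_n^q+i_n=0$. Thus $|\mathcal{R}|=q^{2n-2}$. Forms: $F(X_1,\ldots,X_{n+1})=X_1^{q+1}+\cdots+X_{n-1}^{q+1}+X_n^qX_{n+1}+X_nX_{n+1}^q$, and for $g\in\mathcal{R}$ with parameters $(i_1,\ldots,i_n)$, $F^g(X)=F(XD_g)$, that is, $$F^g=X_1^{q+1}+\cdots+X_{n-1}^{q+1}+X_n^qX_{n+1}+X_nX_{n+1}^q+X_{n+1}^{q+1}\left(i_1^{q+1}+\cdots+i_{n-1}^{q+1}+i_n^q+i_n\right)+\mathrm{tr}\left(X_{n+1}^q(X_1i_1^q+\cdots+X_{n-1}i_{n-1}^q)\right).$$ All values of $F^g$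 on $\mathrm{GF}(q^2)^{n+1}$ lie in $\mathrm{GF}(q)$. -}

module Defs where

open import Algebra.Bundles using (CommutativeRing)
import Algebra.Properties.Semiring.Exp as Exp
import Algebra.Properties.Semiring.Sum as Sum
open import Data.Bool.Base using (if_then_else_)
open import Data.Fin.Base using (Fin; toℕ; fromℕ; inject₁)
open import Data.Fin.Properties using (_≟_)
open import Data.Integer.Base using (ℤ; +_; -[1+_])
open import Data.Nat.Base as ℕ using (ℕ; suc; NonZero)
open import Data.Nat.Primality using (Prime; prime⇒nonZero)
open import Data.Nat.Properties using (m^n≢0)
open import Data.Product.Base using (Σ; ∃; ∃₂; _×_; _,_; proj₁; proj₂)
open import Data.Rational.Base using (ℚ; _/_)
open import Data.Vec.Functional using (Vector; init; last; insertAt)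
open import Function.Base using (_on_; _∘_)
open import Function.Bundles using (Inverse; _⇔_; Equivalence)
open import Function.Definitions using (Injective)
open import Function.Properties.Equivalence using (⇔-isEquivalence)
open import Level using (Level; _⊔_) renaming (suc to lsuc)
open import Relation.Binary.Bundles using (Setoid)
import Relation.Binary.Construct.On as On
open import Relation.Binary.PropositionalEquality as ≡ using (_≡_)
open import Relation.Binary.Structures using (IsEquivalence)
open import Relation.Nullary.Decidable using (does)
open import Relation.Nullary.Negation using (¬_)
open import Relation.Unary using (Pred)

------------------------------------------------------------------------
-- Cardinalities and subsets of setoids

HasCardinality : ∀ {a ℓ} → Setoid a ℓ → ℕ → Set (a ⊔ ℓ)
HasCardinality S n = Inverse S (≡.setoid (Fin n))

Subset : ∀ {a ℓ p} (S : Setoid a ℓ) → Pred (Setoid.Carrier S) p → Setoid (a ⊔ p) ℓ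
Subset S P = On.setoid {B = Σ (Setoid.Carrier S) P} S proj₁

------------------------------------------------------------------------
-- Arithmetic

IsPrimePower : ℕ → Set
IsPrimePower q = ∃₂ λ p k → Prime p × NonZero k × q ≡ p ℕ.^ k

primePower⇒nonZero : ∀ {q} → IsPrimePower q → NonZero q
primePower⇒nonZero (p , k , p-prime , _ , ≡.refl) = m^n≢0 p k {{prime⇒nonZero p-prime}}

-- Powers with integer exponents.
_^ᶻ_ : (q : ℕ) .{{_ : NonZero q}} → ℤ → ℚ
q ^ᶻ (+ k)    = + (q ℕ.^ k) / 1
q ^ᶻ -[1+ k ] = (+ 1 / (q ℕ.^ suc k)) {{m^n≢0 q (suc k)}}

------------------------------------------------------------------------
-- Orthogonal arrays

index : (N q t : ℕ) .{{_ : NonZero q}} → ℚ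
index N q t = (+ N / (q ℕ.^ t)) {{m^n≢0 q t}}

-- A matrix is a family of symbols indexed by a setoid of rows and a setoid of
-- columns; the columns carry no order, and columns with different indices may
-- have the same entries.
module _ {r ℓr c ℓc s ℓs : Level}
         (Row : Setoid r ℓr) (Col : Setoid c ℓc) (Sym : Setoid s ℓs) where

  private
    module Row = Setoid Row
    module Col = Setoid Col
    module Sym = Setoid Sym

  record IsOrthogonalArray {p : Level} (Q : Pred Sym.Carrier p)
                           (A : Row.Carrier → Col.Carrier → Sym.Carrier)
                           (N k q t : ℕ) .{{_ : NonZero q}}
                           : Set (r ⊔ ℓr ⊔ c ⊔ ℓc ⊔ s ⊔ ℓs ⊔ p) where
    field
      cong     : ∀ {g h x y} → g Row.≈ h → x Col.≈ y → A g x Sym.≈ A h y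
      columns  : HasCardinality Col N
      rows     : HasCardinality Row k
      levels   : HasCardinality (Subset Sym Q) q
      entries  : ∀ g x → Q (A g x)
      strength : (g : Fin t → Row.Carrier) → Injective _≡_ Row._≈_ g →
                 (b : Fin t → Sym.Carrier) → (∀ i → Q (b i)) →
                 ∃ λ μ → HasCardinality (Subset Col λ x → ∀ i → A (g i) x Sym.≈ b i) μ
                       × + μ / 1 ≡ index N q t

  IsSimple : (Row.Carrier → Col.Carrier → Sym.Carrier) → Set (r ⊔ c ⊔ ℓc ⊔ ℓs)
  IsSimple A = ∀ x y → (∀ g → A g x Sym.≈ A g y) → x Col.≈ y

------------------------------------------------------------------------
-- Finite fields

record FiniteField (c ℓ : Level) (order : ℕ) : Set (lsuc (c ⊔ ℓ)) where
  field
    commutativeRing : CommutativeRing c ℓ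

  open CommutativeRing commutativeRing public

  field
    1≉0         : ¬ 1# ≈ 0#
    invertible  : ∀ x → ¬ x ≈ 0# → ∃ λ y → x * y ≈ 1#
    cardinality : HasCardinality setoid order

------------------------------------------------------------------------
-- Hermitian forms over GF(q²)

module Hermitian {c ℓ : Level} (q : ℕ) (GFq² : FiniteField c ℓ (q ℕ.^ 2)) where

  open FiniteField GFq²
  open Exp semiring using (_^_)
  open Sum semiring using (sum)

  -- GF(q) as the subfield of GF(q²) fixed by x ↦ x^q.
  GFq : Pred Carrier ℓ
  GFq x = x ^ q ≈ x

  tr : Carrier → Carrier
  tr x = x ^ q + x

  T₀ : Pred Carrier ℓ
  T₀ x = tr x ≈ 0#

  -- The family a lists the representatives a₁ = 0, a₂, …, a_q, with indices
  -- shifted to start at 0.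
  record IsRepresentativeSystem (a : Fin q → Carrier) : Set (c ⊔ ℓ) where
    field
      first    : ∀ i → toℕ i ≡ 0 → a i ≈ 0#
      covers   : ∀ x → ∃ λ i → T₀ (x - a i)
      distinct : ∀ i j → T₀ (a i - a j) → i ≡ j

  Matrix : ℕ → Set c
  Matrix k = Vector (Vector Carrier k) k

  _∷ʳ_ : ∀ {a} {A : Set a} {k} → Vector A k → A → Vector A (suc k)
  _∷ʳ_ {k = k} xs x = insertAt xs (fromℕ k) x

  _≈ᵛ_ : ∀ {k} → Vector Carrier k → Vector Carrier k → Set ℓ
  v ≈ᵛ w = ∀ i → v i ≈ w i

  _≈ᵛ0 : ∀ {k} → Vector Carrier k → Set ℓ
  v ≈ᵛ0 = ∀ i → v i ≈ 0#

  _·_ : ∀ {k} → Vector Carrier k → Matrix k → Vector Carrier k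
  (v · M) j = sum λ i → v i * M i j

  identityMatrix : ∀ {k} → Matrix k
  identityMatrix i j = if does (i ≟ j) then 1# else 0#

  -- Equality of the points of PG(k-1,q²) spanned by two non-zero vectors.
  _∼_ : ∀ {k} → Vector Carrier k → Vector Carrier k → Set (c ⊔ ℓ)
  v ∼ w = ∃ λ s → ¬ s ≈ 0# × (∀ i → v i ≈ s * w i)

  -- Throughout, m = n - 1, so that vectors of length n + 1 have length 2 + m.
  -- For X = (X₁,…,X_{n+1}):  init (init X) = (X₁,…,X_{n-1}),
  -- last (init X) = X_n  and  last X = X_{n+1}.

  F : ∀ {m} → Vector Carrier (2 ℕ.+ m) → Carrier
  F X = sum (λ j → init (init X) j ^ suc q) + Xₙ ^ q * Xₙ₊₁ + Xₙ * Xₙ₊₁ ^ q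
    where
    Xₙ   = last (init X)
    Xₙ₊₁ = last X

  D : ∀ {k} → Vector Carrier k → Matrix (suc k)
  D i = (identityMatrix ∘ inject₁) ∷ʳ (i ∷ʳ 1#)

  F^[_] : ∀ {m} → Vector Carrier (suc m) → Vector Carrier (2 ℕ.+ m) → Carrier
  F^[ i ] X = F (X · D i)

  -- X′ = X D⁻¹ as points of projective space, written without inverting D.
  Maps : ∀ {k} → Vector Carrier k → (X X′ : Vector Carrier (suc k)) → Set (c ⊔ ℓ)
  Maps i X X′ = (X′ · D i) ∼ X

  SameCollineation : ∀ {k} → Vector Carrier k → Vector Carrier k → Set (c ⊔ ℓ)
  SameCollineation i j =
    ∀ X X′ → ¬ (X ≈ᵛ0) → ¬ (X′ ≈ᵛ0) → Maps i X X′ ⇔ Maps j X X′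

  sameCollineation-isEquivalence : ∀ {k} → IsEquivalence (SameCollineation {k})
  sameCollineation-isEquivalence = record
    { refl  = λ _ _ _ _ → ⇔.refl
    ; sym   = λ e X X′ X≉0 X′≉0 → ⇔.sym (e X X′ X≉0 X′≉0)
    ; trans = λ e f X X′ X≉0 X′≉0 → ⇔.trans (e X X′ X≉0 X′≉0) (f X X′ X≉0 X′≉0)
    }
    where module ⇔ = IsEquivalence ⇔-isEquivalence

  vectorSetoid : ℕ → Setoid c ℓ
  vectorSetoid k = record
    { Carrier       = Vector Carrier k
    ; _≈_           = _≈ᵛ_
    ; isEquivalence = record
      { refl  = λ _ → refl
      ; sym   = λ e i → sym (e i)
      ; trans = λ e f i → trans (e i) (f i)
      }
    }

  module _ (a : Fin q → Carrier) where

    C : Pred Carrier ℓ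
    C x = ∃ λ i → x ≈ a i

    record IsParameter {m : ℕ} (i : Vector Carrier (suc m)) : Set ℓ where
      field
        last∈C   : C (last i)
        equation : sum (λ j → init i j ^ suc q) + last i ^ q + last i ≈ 0#

    -- A collineation is stored as its parameters (i₁,…,iₙ), but two of them are
    -- identified when they induce the same map on the points of PG(n,q²).
    𝓡 : ℕ → Setoid (c ⊔ ℓ) (c ⊔ ℓ)
    𝓡 m = Subset collineations IsParameter
      where
      collineations : Setoid c (c ⊔ ℓ)
      collineations = record
        { Carrier       = Vector Carrier (suc m)
        ; isEquivalence = sameCollineation-isEquivalence
        }

    𝓦 : (m : ℕ) → Pred (Vector Carrier (2 ℕ.+ m)) ℓ
    𝓦 m x = last x ≈ 1#

    𝓦₀ : ℕ → Setoid (c ⊔ ℓ) ℓ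
    𝓦₀ m = Subset (vectorSetoid (2 ℕ.+ m)) λ x → 𝓦 m x × C (last (init x))

    𝓐₀ : (m : ℕ) → Setoid.Carrier (𝓡 m) → Setoid.Carrier (𝓦₀ m) → Carrier
    𝓐₀ m (i , _) (x , _) = F^[ i ] x

{-# OPTIONS --safe #-}

-- On affine points the entry of the array is
--   F^g(x) = Σ xⱼ^(q+1) + tr(xₙ) + tr(Σ xⱼ iⱼ^q),  j < n,
-- where i are the parameters of g.  As tr maps C bijectively onto GF(q), a prescribed
-- value of F^g(x) determines xₙ from x₁,…,xₙ₋₁.  For g ≠ h the difference F^g(x) - F^h(x)
-- is tr(ℓ(x)) for a non-zero linear form ℓ in x₁,…,xₙ₋₁, so two prescribed values leave an
-- affine condition tr(ℓ(x)) = b, solved by choosing all coordinates but a pivot freely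
-- and then one of the q elements of trace b.  Simplicity is the non-degeneracy of the trace form.

module Submission where

open import Defs
open import Algebra.Bundles using (CommutativeMonoid; CommutativeSemiring)
import Algebra.Properties.AbelianGroup as AbelianGroupProperties
import Algebra.Properties.CommutativeMonoid.Sum as MonoidSum
import Algebra.Properties.CommutativeSemiring.Binomial as Binomial
import Algebra.Properties.CommutativeSemiring.Exp as CommutativeExp
import Algebra.Properties.Group as GroupProperties
import Algebra.Properties.Ring as RingProperties
import Algebra.Properties.Semiring.Exp as Exp
import Algebra.Properties.Semiring.Mult as SemiringMult
import Algebra.Properties.Semiring.Sum as Sum
import Algebra.Solver.Ring.NaturalCoefficients.Default as SemiringSolver
open import Data.Bool.Base using (if_then_else_)
open import Data.Fin.Base as Fin
  using (Fin; zero; suc; fromℕ; inject₁; punchIn; punchOut; combine; remQuot; funToFin; finToFun)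
import Data.Fin.Properties as Fin
open import Data.Fin.Relation.Unary.Top using (view; ‵fromℕ; ‵inject₁)
open import Data.Integer.Base as ℤ using (+_)
import Data.Integer.Properties as ℤ
open import Data.Nat.Base as ℕ using (ℕ; zero; suc; _∸_; NonZero; _!; s≤s; z≤n)
open import Data.Nat.Combinatorics using (_C_; nCn≡1; k![n∸k]!∣n!)
open import Data.Nat.Combinatorics.Specification using (nCk≡n!/k![n-k]!)
open import Data.Nat.Divisibility using (_∣_; divides; ∣⇒≤; m∣m*n)
open import Data.Nat.DivMod using (m/n*n≡m)
open import Data.Nat.Primality using (Prime; euclidsLemma; prime⇒nonZero; prime⇒nonTrivial)
import Data.Nat.Properties as ℕ
open import Data.Nat.Properties using (_!≢0)
open import Data.Product.Base using (∃; ∃₂; _×_; _,_; proj₁; proj₂)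
open import Data.Product.Relation.Binary.Pointwise.NonDependent using (×-setoid)
open import Data.Rational.Base using (_/_)
open import Data.Rational.Properties using (fromℚᵘ-cong)
open import Data.Rational.Unnormalised.Base using (mkℚᵘ; *≡*)
open import Data.Sum.Base using ([_,_]′)
open import Data.Vec.Functional using (Vector; init; last; insertAt; removeAt; replicate)
open import Data.Vec.Functional.Properties using (insertAt-lookup; insertAt-punchIn)
open import Function.Base using (_∘_; _$_; id)
open import Function.Bundles using (Inverse; Bijection; Equivalence; mk⇔)
import Function.Construct.Composition as Composition
import Function.Construct.Identity as Identity
import Function.Construct.Symmetry as Symmetry
open import Function.Definitions using (Injective)
open import Function.Properties.Bijection using (Bijection⇒Inverse)
open import Level using (Level)
open import Relation.Binary.Bundles using (Setoid)
open import Relation.Binary.Definitions using (Decidable)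
open import Relation.Binary.PropositionalEquality as ≡ using (_≡_; _≢_)
import Relation.Binary.Reasoning.Setoid as SetoidReasoning
open import Relation.Nullary.Decidable using (yes; no; does; map′)
open import Relation.Nullary.Negation using (¬_; contradiction)

-- `FiniteField` supplies the axioms and the number of elements, nothing more. The additivity of x ↦
-- x^q and the law x^(q²) = x therefore rest on adding, respectively multiplying, all elements of
-- the field. A subfield with q elements is not given either; its size is read off the
-- representatives. They are pairwise incongruent modulo `T₀`, so some difference has non-zero
-- trace; dividing by that trace yields trace 1, hence every trace in GF(q), and the traces of the
-- representatives enumerate GF(q). As q < q², there is some u outside GF(q), and u^q - u spans `T₀`
-- over GF(q), which gives every fibre of the trace exactly q elements. Rows are compared as
-- collineations, so a difference between two rows must be turned into a difference among their
-- first n - 1 parameters before a pivot exists. For n = 1 there is a single row, strength 2 holds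
-- vacuously and the index is 1/q; this is why indices are rational.

private
  variable
    a b c ℓ ℓ₁ ℓ₂ : Level
    k m n p : ℕ

-- Cardinalities of setoids and sums over all elements

module _ {S : Setoid a ℓ₁} {T : Setoid b ℓ₂} where

  private
    module S = Setoid S
    module T = Setoid T

  HasCardinality-resp-bijective : HasCardinality S n → (f : S.Carrier → T.Carrier) →
                                  (∀ {x y} → x S.≈ y → f x T.≈ f y) →
                                  (∀ {x y} → f x T.≈ f y → x S.≈ y) →
                                  (∀ y → ∃ λ x → f x T.≈ y) →
                                  HasCardinality T n
  HasCardinality-resp-bijective card f f-cong f-injective f-surjective =
    Composition.inverse (Symmetry.inverse (Bijection⇒Inverse bijection)) card
    where
    bijection : Bijection S T
    bijection = record
      { to        = f
      ; cong      = f-cong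
      ; bijective = f-injective , λ y → proj₁ (f-surjective y) , λ z≈x → T.trans (f-cong z≈x) (proj₂ (f-surjective y))
      }

×-cardinality : {S : Setoid a ℓ₁} {T : Setoid b ℓ₂} →
                HasCardinality S m → HasCardinality T n → HasCardinality (×-setoid S T) (m ℕ.* n)
×-cardinality {m = m} {n = n} {S = S} {T = T} cardS cardT = record
  { to        = λ (x , y) → combine (S.to x) (T.to y)
  ; from      = λ i → S.from (proj₁ (remQuot {m} n i)) , T.from (proj₂ (remQuot {m} n i))
  ; to-cong   = λ (e , f) → ≡.cong₂ combine (S.to-cong e) (T.to-cong f)
  ; from-cong = λ { ≡.refl → Setoid.refl (×-setoid S T) }
  ; inverse   = (λ {i} (e , f) → ≡.trans (≡.cong₂ combine (S.inverseˡ e) (T.inverseˡ f)) (Fin.combine-remQuot {m} n i))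
              , λ { {x , y} ≡.refl →
                    S.inverseʳ (≡.cong proj₁ (Fin.remQuot-combine (S.to x) (T.to y)))
                  , T.inverseʳ (≡.cong proj₂ (Fin.remQuot-combine (S.to x) (T.to y))) }
  }
  where
  module S = Inverse cardS
  module T = Inverse cardT

module _ {S : Setoid a ℓ} (card : HasCardinality S n) where

  open Setoid S
  open Inverse card

  HasCardinality⇒injective : ∀ {x y} → to x ≡ to y → x ≈ y
  HasCardinality⇒injective e = trans (sym (strictlyInverseʳ _)) (inverseʳ e)

  HasCardinality⇒dec : Decidable _≈_
  HasCardinality⇒dec x y = map′ HasCardinality⇒injective to-cong (to x Fin.≟ to y)

  module _ (M : CommutativeMonoid c ℓ₁) where

    private module M = CommutativeMonoid M
    open MonoidSum M using (sum; sum-permute; sum-cong-≋)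

    -- Conjugated by the enumeration, φ becomes a permutation of `Fin n` and merely reorders the
    -- terms. The monoid is arbitrary so that both the sum and the product over a field are covered.
    sum-invariant : (φ : Inverse S S) (f : Carrier → M.Carrier) →
                    (∀ {x y} → x ≈ y → f x M.≈ f y) →
                    sum (f ∘ from) M.≈ sum (f ∘ Inverse.to φ ∘ from)
    sum-invariant φ f f-cong =
      M.trans (sum-permute (f ∘ from) π) (sum-cong-≋ λ i → f-cong (strictlyInverseʳ (Inverse.to φ (from i))))
      where π = Composition.inverse (Composition.inverse (Symmetry.inverse card) φ) card

module _ (M : CommutativeMonoid c ℓ) where

  open CommutativeMonoid M
  open MonoidSum M using (sum; sum-remove; sum-cong-≋; sum-replicate-zero)

  sum-single : (t : Vector Carrier n) (j : Fin n) → (∀ i → i ≢ j → t i ≈ ε) → sum t ≈ t j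
  sum-single {suc n} t j t≈0 =
    trans (sum-remove {i = j} t) $
    trans (∙-congˡ (trans (sum-cong-≋ λ i → t≈0 (punchIn j i) (Fin.punchInᵢ≢i j i)) (sum-replicate-zero n)))
          (identityʳ (t j))

-- Binomial coefficients modulo p and the Frobenius map

prime∣!⇒≤ : Prime p → ∀ k → p ∣ k ! → p ℕ.≤ k
prime∣!⇒≤ p-prime zero    p∣1 =
  contradiction (∣⇒≤ p∣1) (ℕ.<⇒≱ (ℕ.nonTrivial⇒n>1 _ {{prime⇒nonTrivial p-prime}}))
prime∣!⇒≤ p-prime (suc k) p∣  =
  [ ∣⇒≤ , ℕ.m≤n⇒m≤1+n ∘ prime∣!⇒≤ p-prime k ]′ (euclidsLemma (suc k) (k !) p-prime p∣)

-- By Euclid's lemma applied to p! = (p C k) · k! (p - k)!: every factor of k! and of (p - k)! is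
-- smaller than p, so p must divide the coefficient.
prime∣C : Prime p → 0 ℕ.< k → k ℕ.< p → p ∣ p C k
prime∣C {p} {k} p-prime 0<k k<p =
  [ id , (λ p∣d → contradiction p∣d ∤d) ]′ (euclidsLemma (p C k) d p-prime p∣C*d)
  where
  d = k ! ℕ.* (p ∸ k) !
  instance
    p≢0 = prime⇒nonZero p-prime
    d≢0 : NonZero d
    d≢0 = ℕ.m*n≢0 (k !) ((p ∸ k) !) {{k !≢0}} {{(p ∸ k) !≢0}}
  k≤p = ℕ.<⇒≤ k<p
  C*d≡p! : (p C k) ℕ.* d ≡ p !
  C*d≡p! = ≡.trans (≡.cong (ℕ._* d) (nCk≡n!/k![n-k]! k≤p)) (m/n*n≡m (k![n∸k]!∣n! k≤p))
  p∣p! : ∀ n → .{{NonZero n}} → n ∣ n !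
  p∣p! (suc n) = m∣m*n (n !)
  p∣C*d : p ∣ (p C k) ℕ.* d
  p∣C*d = ≡.subst (p ∣_) (≡.sym C*d≡p!) (p∣p! p)
  ∤d : ¬ p ∣ d
  ∤d p∣d = [ (λ e → ℕ.<⇒≱ k<p (prime∣!⇒≤ p-prime k e))
           , (λ e → ℕ.<⇒≱ (ℕ.∸-monoʳ-< 0<k k≤p) (prime∣!⇒≤ p-prime (p ∸ k) e))
           ]′ (euclidsLemma (k !) ((p ∸ k) !) p-prime p∣d)

module Frobenius (R : CommutativeSemiring c ℓ) (p-prime : Prime p) where

  open CommutativeSemiring R hiding (zero)
  open Exp semiring
  open Sum semiring using (sum; sum-init-last; sum-cong-≋; sum-replicate-zero)
  open SemiringMult semiring renaming (_×_ to _×ᴿ_)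
  open Binomial R using (binomialTerm; theorem)
  open SetoidReasoning setoid

  module _ (p×1≈0 : p ×ᴿ 1# ≈ 0#) where

    ∣⇒×≈0 : ∀ {n} → p ∣ n → ∀ x → n ×ᴿ x ≈ 0#
    ∣⇒×≈0 {n} (divides m ≡.refl) x = begin
      n ×ᴿ x                         ≈⟨ ×-congʳ n (*-identityˡ x) ⟨
      n ×ᴿ (1# * x)                  ≈⟨ ×-assoc-* n 1# x ⟨
      (n ×ᴿ 1#) * x                  ≈⟨ *-congʳ (×1-homo-* m p) ⟩
      (m ×ᴿ 1#) * (p ×ᴿ 1#) * x      ≈⟨ *-congʳ (*-congˡ p×1≈0) ⟩
      (m ×ᴿ 1#) * 0# * x             ≈⟨ *-congʳ (zeroʳ _) ⟩
      0# * x                         ≈⟨ zeroˡ x ⟩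
      0#                             ∎

    -- In the binomial theorem all coefficients except the two outer ones are divisible by p.
    ^p-+ : ∀ x y → (x + y) ^ p ≈ x ^ p + y ^ p
    ^p-+ x y = go p ≡.refl
      where
      -- The parameter p is fixed by the module, so the match that exposes it as a successor is made
      -- on a copy n. Being a successor splits the p + 1 terms into first, middle and last.
      go : ∀ n → n ≡ p → (x + y) ^ n ≈ x ^ n + y ^ n
      go zero     ≡.refl = contradiction (prime⇒nonZero p-prime) λ ()
      go (suc p′) ≡.refl = begin
        (x + y) ^ p                                   ≈⟨ theorem p x y ⟩
        term zero + sum (term ∘ suc)                   ≈⟨ +-congˡ (sum-init-last (term ∘ suc)) ⟩
        term zero + (sum (init (term ∘ suc)) + term (suc (fromℕ p′)))
          ≈⟨ +-congˡ (+-congʳ (trans (sum-cong-≋ middle) (sum-replicate-zero p′))) ⟩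
        term zero + (0# + term (suc (fromℕ p′)))       ≈⟨ +-congˡ (+-identityˡ _) ⟩
        term zero + term (suc (fromℕ p′))              ≈⟨ +-cong first final ⟩
        y ^ p + x ^ p                                ≈⟨ +-comm _ _ ⟩
        x ^ p + y ^ p                                ∎
        where
        term = binomialTerm x y p
        middle : ∀ i → term (suc (inject₁ i)) ≈ 0#
        middle i = ∣⇒×≈0 (prime∣C p-prime (s≤s z≤n)
                     (s≤s (≡.subst (ℕ._< p′) (≡.sym (Fin.toℕ-inject₁ i)) (Fin.toℕ<n i)))) _
        first : term zero ≈ y ^ p
        first = trans (×-homo-1 _) (*-identityˡ _)
        final : term (suc (fromℕ p′)) ≈ x ^ p
        final = begin
          term (suc (fromℕ p′))
            ≡⟨ ≡.cong (λ i → (p C suc i) ×ᴿ (x ^ suc i * y ^ (p′ ∸ i))) (Fin.toℕ-fromℕ p′) ⟩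
          (p C p) ×ᴿ (x ^ p * y ^ (p′ ∸ p′))
            ≡⟨ ≡.cong (λ i → (p C p) ×ᴿ (x ^ p * y ^ i)) (ℕ.n∸n≡0 p′) ⟩
          (p C p) ×ᴿ (x ^ p * 1#)   ≡⟨ ≡.cong (_×ᴿ (x ^ p * 1#)) (nCn≡1 p) ⟩
          1 ×ᴿ (x ^ p * 1#)         ≈⟨ ×-homo-1 _ ⟩
          x ^ p * 1#                ≈⟨ *-identityʳ _ ⟩
          x ^ p                     ∎

    ^p^-+ : ∀ k x y → (x + y) ^ (p ℕ.^ k) ≈ x ^ (p ℕ.^ k) + y ^ (p ℕ.^ k)
    ^p^-+ zero    x y = trans (*-identityʳ _) (sym (+-cong (*-identityʳ x) (*-identityʳ y)))
    ^p^-+ (suc k) x y = begin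
      (x + y) ^ (p ℕ.^ suc k)                             ≈⟨ ^-assocʳ (x + y) p (p ℕ.^ k) ⟨
      ((x + y) ^ p) ^ (p ℕ.^ k)                          ≈⟨ ^-congˡ (p ℕ.^ k) (^p-+ x y) ⟩
      (x ^ p + y ^ p) ^ (p ℕ.^ k)                       ≈⟨ ^p^-+ k _ _ ⟩
      (x ^ p) ^ (p ℕ.^ k) + (y ^ p) ^ (p ℕ.^ k)          ≈⟨ +-cong (^-assocʳ x p (p ℕ.^ k)) (^-assocʳ y p (p ℕ.^ k)) ⟩
      x ^ (p ℕ.^ suc k) + y ^ (p ℕ.^ suc k)                ∎

-- Finite fields: characteristic and the law x^N = x

module FiniteFieldProperties {N : ℕ} (K : FiniteField c ℓ N) where

  open FiniteField K hiding (zero)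
  open Exp semiring
  open SemiringMult semiring renaming (_×_ to _×ᴷ_)
  open SetoidReasoning setoid
  private
    module Card = Inverse cardinality
    module ∑ = MonoidSum +-commutativeMonoid
    module ∏ = MonoidSum *-commutativeMonoid

  infix 4 _≈?_
  -- The decision compares positions in the enumeration; opacity keeps these from unfolding in the
  -- case distinctions below.
  opaque
    _≈?_ : Decidable _≈_
    _≈?_ = HasCardinality⇒dec cardinality

  *-cancelˡ-≉0 : ∀ {x y z} → ¬ x ≈ 0# → x * y ≈ x * z → y ≈ z
  *-cancelˡ-≉0 {x} {y} {z} x≉0 xy≈xz =
    let x⁻¹ , xx⁻¹≈1 = invertible x x≉0
        cancel : ∀ w → x⁻¹ * (x * w) ≈ w
        cancel w = begin
          x⁻¹ * (x * w) ≈⟨ *-assoc _ _ _ ⟨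
          x⁻¹ * x * w   ≈⟨ *-congʳ (trans (*-comm _ _) xx⁻¹≈1) ⟩
          1# * w        ≈⟨ *-identityˡ w ⟩
          w             ∎
    in trans (sym (cancel y)) (trans (*-congˡ xy≈xz) (cancel z))

  *≈0⇒≈0 : ∀ {x y} → ¬ x ≈ 0# → x * y ≈ 0# → y ≈ 0#
  *≈0⇒≈0 x≉0 xy≈0 = *-cancelˡ-≉0 x≉0 (trans xy≈0 (sym (zeroʳ _)))

  *≉0 : ∀ {x y} → ¬ x ≈ 0# → ¬ y ≈ 0# → ¬ x * y ≈ 0#
  *≉0 x≉0 y≉0 xy≈0 = y≉0 (*≈0⇒≈0 x≉0 xy≈0)

  ^≈0⇒≈0 : ∀ n {x} → x ^ n ≈ 0# → x ≈ 0#
  ^≈0⇒≈0 zero        1≈0 = contradiction 1≈0 1≉0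
  ^≈0⇒≈0 (suc n) {x} xxⁿ≈0 with x ≈? 0#
  ... | yes x≈0 = x≈0
  ... | no  x≉0 = ^≈0⇒≈0 n (*≈0⇒≈0 x≉0 xxⁿ≈0)

  translation : Carrier → Inverse setoid setoid
  translation y = record
    { to        = _+ y
    ; from      = _- y
    ; to-cong   = +-congʳ
    ; from-cong = +-congʳ
    ; inverse   = (λ {x} e → trans (+-congʳ e) (//-rightDividesˡ y x))
                , (λ {x} e → trans (+-congʳ e) (//-rightDividesʳ y x))
    }
    where open GroupProperties +-group

  scaling : ∀ {y} → ¬ y ≈ 0# → Inverse setoid setoid
  scaling {y} y≉0 = record
    { to        = y *_
    ; from      = y⁻¹ *_
    ; to-cong   = *-congˡ
    ; from-cong = *-congˡ
    ; inverse   = (λ {x} e → trans (*-congˡ e) (cancel yy⁻¹≈1 x))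
                , (λ {x} e → trans (*-congˡ e) (cancel (trans (*-comm _ _) yy⁻¹≈1) x))
    }
    where
    y⁻¹ = proj₁ (invertible y y≉0)
    yy⁻¹≈1 = proj₂ (invertible y y≉0)
    cancel : ∀ {u v} → u * v ≈ 1# → ∀ x → u * (v * x) ≈ x
    cancel uv≈1 x = trans (sym (*-assoc _ _ x)) (trans (*-congʳ uv≈1) (*-identityˡ x))

  -- Translation by 1 permutes the field, hence preserves the sum of all elements, and yet it adds N
  -- times 1 to that sum.
  order×1≈0 : N ×ᴷ 1# ≈ 0#
  order×1≈0 = identityʳ-unique S (N ×ᴷ 1#) (begin
    S + N ×ᴷ 1#                         ≈⟨ +-congˡ (∑.sum-replicate N) ⟨
    S + ∑.sum (replicate N 1#)          ≈⟨ ∑.∑-distrib-+ Card.from (replicate N 1#) ⟨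
    ∑.sum (λ i → Card.from i + 1#)      ≈⟨ sum-invariant cardinality +-commutativeMonoid (translation 1#) id id ⟨
    S                                   ∎)
    where
    open GroupProperties +-group using (identityʳ-unique)
    S = ∑.sum Card.from

  -- The product of all non-zero elements is invariant under multiplication by x;
  -- 0 is kept among the factors, replaced by 1, so that the index set is all of K.
  ^order : ∀ x → x ^ N ≈ x
  ^order x with x ≈? 0#
  ... | yes x≈0 = trans (^-congˡ N x≈0) (trans (go N ≡.refl) (sym x≈0))
    where
    go : ∀ n → n ≡ N → 0# ^ n ≈ 0#
    go zero    ≡.refl = contradiction (Card.to 0#) Fin.¬Fin0
    go (suc n) _      = zeroˡ _
  ... | no x≉0 = *-cancelˡ-≉0 P≉0 (begin
    P * x ^ N                                     ≈⟨ *-comm _ _ ⟩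
    x ^ N * P                                     ≈⟨ *-congʳ (∏.sum-replicate N) ⟨
    ∏.sum (replicate N x) * P                      ≈⟨ ∏.∑-distrib-+ (replicate N x) (f ∘ Card.from) ⟨
    ∏.sum (λ i → x * f (Card.from i))              ≈⟨ ∏.sum-cong-≋ (λ i → f-scale (Card.from i)) ⟨
    ∏.sum (λ i → f (x * Card.from i) * δ (Card.from i))
      ≈⟨ ∏.∑-distrib-+ (λ i → f (x * Card.from i)) (δ ∘ Card.from) ⟩
    ∏.sum (λ i → f (x * Card.from i)) * ∏.sum (δ ∘ Card.from)
      ≈⟨ *-cong (sum-invariant cardinality *-commutativeMonoid (scaling x≉0) f f-cong) (sym ∏δ≈x) ⟨
    P * x                                          ∎)
    where
    f δ : Carrier → Carrier
    f y = if does (y ≈? 0#) then 1# else y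
    -- Scaling the factors of the product fails only at y = 0, where `f` takes the value 1 before
    -- and after. `δ` repairs this place; its product over the field is a single x, hence x^N and
    -- not x^(N-1) in the result.
    δ y = if does (y ≈? 0#) then x else 1#
    P = ∏.sum (f ∘ Card.from)

    f-cong : ∀ {y z} → y ≈ z → f y ≈ f z
    f-cong {y} {z} y≈z with y ≈? 0# | z ≈? 0#
    ... | yes _   | yes _   = refl
    ... | yes y≈0 | no z≉0  = contradiction (trans (sym y≈z) y≈0) z≉0
    ... | no y≉0  | yes z≈0 = contradiction (trans y≈z z≈0) y≉0
    ... | no _    | no _    = y≈z

    f≉0 : ∀ y → ¬ f y ≈ 0#
    f≉0 y with y ≈? 0#
    ... | yes _  = 1≉0
    ... | no y≉0 = y≉0

    f-scale : ∀ y → f (x * y) * δ y ≈ x * f y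
    f-scale y with y ≈? 0# | x * y ≈? 0#
    ... | yes _   | yes _    = *-comm 1# x
    ... | yes y≈0 | no xy≉0  = contradiction (trans (*-congˡ y≈0) (zeroʳ x)) xy≉0
    ... | no y≉0  | yes xy≈0 = contradiction (*≈0⇒≈0 x≉0 xy≈0) y≉0
    ... | no _    | no _     = *-identityʳ _

    ∏≉0 : ∀ {n} (t : Vector Carrier n) → (∀ i → ¬ t i ≈ 0#) → ¬ ∏.sum t ≈ 0#
    ∏≉0 {zero}  t t≉0 = 1≉0
    ∏≉0 {suc n} t t≉0 = *≉0 (t≉0 zero) (∏≉0 (t ∘ suc) (t≉0 ∘ suc))

    P≉0 : ¬ P ≈ 0#
    P≉0 = ∏≉0 (f ∘ Card.from) (f≉0 ∘ Card.from)

    ∏δ≈x : ∏.sum (δ ∘ Card.from) ≈ x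
    ∏δ≈x = trans (sum-single *-commutativeMonoid (δ ∘ Card.from) (Card.to 0#) δ≈1) δ0≈x
      where
      δ≈1 : ∀ i → i ≢ Card.to 0# → δ (Card.from i) ≈ 1#
      δ≈1 i i≢ with Card.from i ≈? 0#
      ... | yes e = contradiction (≡.sym (Card.inverseˡ (sym e))) i≢
      ... | no _  = refl
      δ0≈x : δ (Card.from (Card.to 0#)) ≈ x
      δ0≈x with Card.from (Card.to 0#) ≈? 0#
      ... | yes _ = refl
      ... | no ≉0 = contradiction (Card.inverseʳ ≡.refl) ≉0

  -- The map n ↦ n · 1 is multiplicative, so N · 1 = (p · 1)^k. The left side vanishes, and a field
  -- has no nilpotent elements besides 0.
  characteristic : ∀ p k → N ≡ p ℕ.^ k → p ×ᴷ 1# ≈ 0#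
  characteristic p k ≡.refl = ^≈0⇒≈0 k (trans (sym (×1-^ k)) order×1≈0)
    where
    ×1-^ : ∀ k → (p ℕ.^ k) ×ᴷ 1# ≈ (p ×ᴷ 1#) ^ k
    ×1-^ zero    = ×-homo-1 1#
    ×1-^ (suc k) = trans (×1-homo-* p (p ℕ.^ k)) (*-congˡ (×1-^ k))

-- Vectors with a distinguished coordinate, and arithmetic of the index

primePower⇒>1 : ∀ {q} → IsPrimePower q → 1 ℕ.< q
primePower⇒>1 (p , suc k , p-prime , _ , ≡.refl) =
  ℕ.<-≤-trans (ℕ.nonTrivial⇒n>1 p {{prime⇒nonTrivial p-prime}})
              (ℕ.m≤m*n p (p ℕ.^ k) {{ℕ.m^n≢0 p k {{prime⇒nonZero p-prime}}}})

>1⇒distinct : 1 ℕ.< n → ∃₂ λ (i j : Fin n) → i ≢ j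
>1⇒distinct (s≤s (s≤s _)) = zero , suc zero , λ ()

init-insertAt-fromℕ : ∀ {A : Set b} {k} (xs : Vector A k) x j → insertAt xs (fromℕ k) x (inject₁ j) ≡ xs j
init-insertAt-fromℕ xs x zero    = ≡.refl
init-insertAt-fromℕ xs x (suc j) = init-insertAt-fromℕ (xs ∘ suc) x j

last-insertAt-fromℕ : ∀ {A : Set b} {k} (xs : Vector A k) x → insertAt xs (fromℕ k) x (fromℕ k) ≡ x
last-insertAt-fromℕ {k = k} xs x = insertAt-lookup xs (fromℕ k) x

init-last-elim : (P : Fin (suc n) → Set ℓ) → (∀ j → P (inject₁ j)) → P (fromℕ n) → ∀ i → P i
init-last-elim P Pinit Plast i with view i
... | ‵inject₁ j = Pinit j
... | ‵fromℕ     = Plast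

punchIn-elim : (P : Fin (suc n) → Set ℓ) → ∀ i → P i → (∀ j → P (punchIn i j)) → ∀ j → P j
punchIn-elim P i Pi PpunchIn j with i Fin.≟ j
... | yes ≡.refl = Pi
... | no i≢j     = ≡.subst P (Fin.punchIn-punchOut i≢j) (PpunchIn (punchOut i≢j))

fraction-≡ : ∀ i j {k l} .{{_ : NonZero k}} .{{_ : NonZero l}} → i ℕ.* l ≡ j ℕ.* k → + i / k ≡ + j / l
fraction-≡ i j {suc k} {suc l} e = fromℚᵘ-cong {mkℚᵘ (+ i) k} {mkℚᵘ (+ j) l}
  (*≡* (≡.trans (≡.sym (ℤ.pos-* i (suc l))) (≡.trans (≡.cong +_ e) (ℤ.pos-* j (suc k)))))

^[2*suc∸1] : ∀ q m → q ℕ.^ (2 ℕ.* suc m ∸ 1) ≡ (q ℕ.^ 2) ℕ.^ m ℕ.* q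
^[2*suc∸1] q m = begin
  q ℕ.^ (2 ℕ.* suc m ∸ 1)   ≡⟨ ≡.cong (λ e → q ℕ.^ (e ∸ 1)) (ℕ.*-suc 2 m) ⟩
  q ℕ.* q ℕ.^ (2 ℕ.* m)     ≡⟨ ℕ.*-comm q _ ⟩
  q ℕ.^ (2 ℕ.* m) ℕ.* q     ≡⟨ ≡.cong (ℕ._* q) (ℕ.^-*-assoc q 2 m) ⟨
  (q ℕ.^ 2) ℕ.^ m ℕ.* q     ∎
  where open ≡.≡-Reasoning

^[2*suc∸2] : ∀ q m → q ℕ.^ (2 ℕ.* suc m ∸ 2) ≡ (q ℕ.^ 2) ℕ.^ m
^[2*suc∸2] q m = ≡.trans (≡.cong (λ e → q ℕ.^ (e ∸ 2)) (ℕ.*-suc 2 m)) (≡.sym (ℕ.^-*-assoc q 2 m))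

-- The numerator on the left is the count delivered by `hyperplane-cardinality`. Here m stands for n
-- - 2, since two distinct rows exist only from n = 2 on.
index-column : ∀ q m .{{_ : NonZero q}} →
               + ((q ℕ.^ 2) ℕ.^ m ℕ.* q) / 1 ≡ index (q ℕ.^ (2 ℕ.* suc (suc m) ∸ 1)) q 2
index-column q m = fraction-≡ ((q ℕ.^ 2) ℕ.^ m ℕ.* q) (q ℕ.^ (2 ℕ.* suc (suc m) ∸ 1)) {{_}} {{ℕ.m^n≢0 q 2}} (begin
  (q ℕ.^ 2) ℕ.^ m ℕ.* q ℕ.* q ℕ.^ 2      ≡⟨ ℕ.*-comm _ (q ℕ.^ 2) ⟩
  q ℕ.^ 2 ℕ.* ((q ℕ.^ 2) ℕ.^ m ℕ.* q)    ≡⟨ ℕ.*-assoc (q ℕ.^ 2) _ q ⟨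
  (q ℕ.^ 2) ℕ.^ suc m ℕ.* q              ≡⟨ ^[2*suc∸1] q (suc m) ⟨
  q ℕ.^ (2 ℕ.* suc (suc m) ∸ 1)          ≡⟨ ℕ.*-identityʳ _ ⟨
  q ℕ.^ (2 ℕ.* suc (suc m) ∸ 1) ℕ.* 1    ∎)
  where open ≡.≡-Reasoning

-- The case n = 1 is separate because only there the exponent 2n - 3 is negative.
index-^ᶻ : ∀ q m .{{_ : NonZero q}} →
           index (q ℕ.^ (2 ℕ.* suc m ∸ 1)) q 2 ≡ q ^ᶻ (+ (2 ℕ.* suc m) ℤ.- + 3)
index-^ᶻ q zero    = fraction-≡ (q ℕ.^ 1) 1 {{ℕ.m^n≢0 q 2}} {{ℕ.m^n≢0 q 1}}
  (≡.trans (≡.sym (ℕ.^-distribˡ-+-* q 1 1)) (≡.sym (ℕ.*-identityˡ _)))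
index-^ᶻ q (suc m) = begin
  index (q ℕ.^ (2 ℕ.* suc (suc m) ∸ 1)) q 2    ≡⟨ index-column q m ⟨
  + ((q ℕ.^ 2) ℕ.^ m ℕ.* q) / 1                ≡⟨ ≡.cong (λ r → + r / 1) (^[2*suc∸1] q m) ⟨
  q ^ᶻ (+ (2 ℕ.* suc m ∸ 1))                   ≡⟨ ≡.cong (λ e → q ^ᶻ (+ (e ∸ 1))) (ℕ.*-suc 2 m) ⟩
  -- With the exponent in the form 4 + 2m the integer subtraction of 3 computes.
  q ^ᶻ (+ (4 ℕ.+ 2 ℕ.* m) ℤ.- + 3)
    ≡⟨ ≡.cong (λ e → q ^ᶻ (+ e ℤ.- + 3)) (≡.trans (ℕ.*-suc 2 (suc m)) (≡.cong (2 ℕ.+_) (ℕ.*-suc 2 m))) ⟨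
  q ^ᶻ (+ (2 ℕ.* suc (suc m)) ℤ.- + 3)         ∎
  where open ≡.≡-Reasoning

funToFin-cong : {f g : Fin m → Fin n} → (∀ i → f i ≡ g i) → funToFin f ≡ funToFin g
funToFin-cong {zero}  e = ≡.refl
funToFin-cong {suc m} e = ≡.cong₂ Fin.combine (e zero) (funToFin-cong (e ∘ suc))

-- Conjugation over GF(q²)

module HermitianProperties (q : ℕ) (pp : IsPrimePower q) (K : FiniteField c ℓ (q ℕ.^ 2)) where

  open FiniteField K hiding (zero)
  open FiniteFieldProperties K
  open Hermitian q K
  open Exp semiring
  open CommutativeExp commutativeSemiring using (^-distrib-*)
  open Sum semiring using (sum; sum-init-last; sum-remove; sum-cong-≋; sum-replicate-zero; ∑-distrib-+)
  open AbelianGroupProperties +-abelianGroup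
    renaming ( x∙y⁻¹≈ε⇒x≈y to x-y≈0⇒x≈y; x≈y⇒x∙y⁻¹≈ε to x≈y⇒x-y≈0
             ; ∙-cancelˡ to +-cancelˡ; ∙-cancelʳ to +-cancelʳ)
  open RingProperties ring using (-‿distribˡ-*)
  open SemiringSolver commutativeSemiring using (solve; _:=_; _:+_; _:*_)
  open SetoidReasoning setoid

  private
    module Card = Inverse cardinality

  conj : Carrier → Carrier
  conj x = x ^ q

  conj-cong : ∀ {x y} → x ≈ y → conj x ≈ conj y
  conj-cong = ^-congˡ q

  -- If q = p^k, the field has p^(2k) elements and so characteristic p; conjugation is then the k-th
  -- iterate of the Frobenius map.
  conj-+ : ∀ x y → conj (x + y) ≈ conj x + conj y
  conj-+ x y = go pp
    where
    go : IsPrimePower q → conj (x + y) ≈ conj x + conj y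
    go (p , k , p-prime , _ , q≡pᵏ) =
      ≡.subst (λ r → (x + y) ^ r ≈ x ^ r + y ^ r) (≡.sym q≡pᵏ)
        (Frobenius.^p^-+ commutativeSemiring p-prime
          (characteristic p (k ℕ.* 2) (≡.trans (≡.cong (ℕ._^ 2) q≡pᵏ) (ℕ.^-*-assoc p k 2))) k x y)

  conj-* : ∀ x y → conj (x * y) ≈ conj x * conj y
  conj-* x y = ^-distrib-* x y q

  conj-conj : ∀ x → conj (conj x) ≈ x
  conj-conj x = begin
    (x ^ q) ^ q         ≈⟨ ^-assocʳ x q q ⟩
    x ^ (q ℕ.* q)       ≡⟨ ≡.cong (λ r → x ^ (q ℕ.* r)) (ℕ.*-identityʳ q) ⟨
    x ^ (q ℕ.^ 2)       ≈⟨ ^order x ⟩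
    x                   ∎

  conj-0 : conj 0# ≈ 0#
  conj-0 = identityʳ-unique (conj 0#) (conj 0#) (trans (sym (conj-+ 0# 0#)) (conj-cong (+-identityʳ 0#)))

  conj-1 : conj 1# ≈ 1#
  conj-1 = begin
    conj 1#               ≈⟨ *-identityʳ _ ⟨
    conj 1# * 1#          ≈⟨ *-congˡ (conj-conj 1#) ⟨
    conj 1# * conj (conj 1#) ≈⟨ conj-* 1# (conj 1#) ⟨
    conj (1# * conj 1#)   ≈⟨ conj-cong (*-identityˡ _) ⟩
    conj (conj 1#)        ≈⟨ conj-conj 1# ⟩
    1#                    ∎

  conj-neg : ∀ x → conj (- x) ≈ - conj x
  conj-neg x = inverseˡ-unique _ _ (begin
    conj (- x) + conj x   ≈⟨ conj-+ (- x) x ⟨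
    conj (- x + x)        ≈⟨ conj-cong (-‿inverseˡ x) ⟩
    conj 0#               ≈⟨ conj-0 ⟩
    0#                    ∎)

  conj-≉0 : ∀ {x} → ¬ x ≈ 0# → ¬ conj x ≈ 0#
  conj-≉0 x≉0 = x≉0 ∘ ^≈0⇒≈0 q

  -- The subfield GF(q)

  GFq-resp : ∀ {x y} → x ≈ y → GFq x → GFq y
  GFq-resp x≈y x∈ = trans (conj-cong (sym x≈y)) (trans x∈ x≈y)

  GFq-0 : GFq 0#
  GFq-0 = conj-0

  GFq-+ : ∀ {x y} → GFq x → GFq y → GFq (x + y)
  GFq-+ x∈ y∈ = trans (conj-+ _ _) (+-cong x∈ y∈)

  GFq-neg : ∀ {x} → GFq x → GFq (- x)
  GFq-neg x∈ = trans (conj-neg _) (-‿cong x∈)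

  GFq-inverse : ∀ {x y} → ¬ x ≈ 0# → x * y ≈ 1# → GFq x → GFq y
  GFq-inverse {x} {y} x≉0 xy≈1 x∈ = *-cancelˡ-≉0 x≉0 (begin
    x * conj y        ≈⟨ *-congʳ x∈ ⟨
    conj x * conj y   ≈⟨ conj-* x y ⟨
    conj (x * y)      ≈⟨ conj-cong xy≈1 ⟩
    conj 1#           ≈⟨ conj-1 ⟩
    1#                ≈⟨ xy≈1 ⟨
    x * y             ∎)

  GFq-norm : ∀ x → GFq (x ^ suc q)
  GFq-norm x = trans (conj-* x (conj x)) (trans (*-congˡ (conj-conj x)) (*-comm _ _))

  GFq-sum : (t : Vector Carrier n) → (∀ i → GFq (t i)) → GFq (sum t)
  GFq-sum {zero}  t t∈ = GFq-0
  GFq-sum {suc n} t t∈ = GFq-+ (t∈ zero) (GFq-sum (t ∘ suc) (t∈ ∘ suc))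

  -- The trace

  tr-cong : ∀ {x y} → x ≈ y → tr x ≈ tr y
  tr-cong e = +-cong (conj-cong e) e

  tr-+ : ∀ x y → tr (x + y) ≈ tr x + tr y
  tr-+ x y = trans (+-congʳ (conj-+ x y))
    (solve 4 (λ x y x̄ ȳ → (x̄ :+ ȳ) :+ (x :+ y) := (x̄ :+ x) :+ (ȳ :+ y)) refl x y (conj x) (conj y))

  tr-0 : tr 0# ≈ 0#
  tr-0 = trans (+-identityʳ _) conj-0

  tr-neg : ∀ x → tr (- x) ≈ - tr x
  tr-neg x = inverseˡ-unique _ _ (trans (sym (tr-+ (- x) x)) (trans (tr-cong (-‿inverseˡ x)) tr-0))

  tr-∸ : ∀ x y → tr (x - y) ≈ tr x - tr y
  tr-∸ x y = trans (tr-+ x (- y)) (+-congˡ (tr-neg y))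

  tr-sum : (t : Vector Carrier n) → tr (sum t) ≈ sum (tr ∘ t)
  tr-sum {zero}  t = tr-0
  tr-sum {suc n} t = trans (tr-+ _ _) (+-congˡ (tr-sum (t ∘ suc)))

  tr-∈GFq : ∀ x → GFq (tr x)
  tr-∈GFq x = trans (conj-+ (conj x) x) (trans (+-congʳ (conj-conj x)) (+-comm _ _))

  tr-scale : ∀ {s} → GFq s → ∀ x → tr (s * x) ≈ s * tr x
  tr-scale {s} s∈ x = trans (+-congʳ (trans (conj-* s x) (*-congʳ s∈))) (sym (distribˡ s (conj x) x))

  -- The two mixed products are conjugate to each other and add up to a trace.
  norm-+ : ∀ x y → (x + y) ^ suc q ≈ x ^ suc q + y ^ suc q + tr (x * conj y)
  norm-+ x y = begin
    (x + y) * conj (x + y)          ≈⟨ *-congˡ (conj-+ x y) ⟩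
    (x + y) * (conj x + conj y)
      ≈⟨ solve 4 (λ x y x̄ ȳ → (x :+ y) :* (x̄ :+ ȳ) := (x :* x̄) :+ (y :* ȳ) :+ ((x̄ :* y) :+ (x :* ȳ)))
                 refl x y (conj x) (conj y) ⟩
    x ^ suc q + y ^ suc q + (conj x * y + x * conj y)
      ≈⟨ +-congˡ (+-congʳ (trans (conj-* x (conj y)) (*-congˡ (conj-conj y)))) ⟨
    x ^ suc q + y ^ suc q + tr (x * conj y) ∎

  -- Hermitian forms in coordinates

  normSum : Vector Carrier m → Carrier
  normSum x = sum (λ j → x j ^ suc q)

  ⟨_,_⟩ : Vector Carrier m → Vector Carrier m → Carrier
  ⟨ x , v ⟩ = sum (λ j → x j * conj (v j))

  -- Closed form of the entry, with v the first n - 1 parameters of the row, and x and y the first n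
  -- - 1 coordinates and the n-th coordinate of the column. The n-th parameter has been eliminated
  -- by the equation that defines the rows.
  value : Vector Carrier m → Vector Carrier m → Carrier → Carrier
  value v x y = normSum x + tr y + tr ⟨ x , v ⟩

  normSum-cong : {x y : Vector Carrier m} → x ≈ᵛ y → normSum x ≈ normSum y
  normSum-cong e = sum-cong-≋ (λ j → ^-congˡ (suc q) (e j))

  ⟨,⟩-cong : {x y v w : Vector Carrier m} → x ≈ᵛ y → v ≈ᵛ w → ⟨ x , v ⟩ ≈ ⟨ y , w ⟩
  ⟨,⟩-cong e f = sum-cong-≋ (λ j → *-cong (e j) (conj-cong (f j)))

  value-cong : {v w x x′ : Vector Carrier m} {y y′ : Carrier} →
               v ≈ᵛ w → x ≈ᵛ x′ → y ≈ y′ → value v x y ≈ value w x′ y′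
  value-cong e f g = +-cong (+-cong (normSum-cong f) (tr-cong g)) (tr-cong (⟨,⟩-cong f e))

  GFq-normSum : (x : Vector Carrier m) → GFq (normSum x)
  GFq-normSum x = GFq-sum _ (λ j → GFq-norm (x j))

  GFq-value : (v x : Vector Carrier m) → ∀ y → GFq (value v x y)
  GFq-value v x y = GFq-+ (GFq-+ (GFq-normSum x) (tr-∈GFq y)) (tr-∈GFq _)

  normSum-+ : (x v : Vector Carrier m) →
              normSum (λ j → x j + v j) ≈ normSum x + normSum v + tr ⟨ x , v ⟩
  normSum-+ x v = begin
    normSum (λ j → x j + v j)
      ≈⟨ sum-cong-≋ (λ j → norm-+ (x j) (v j)) ⟩
    sum (λ j → x j ^ suc q + v j ^ suc q + tr (x j * conj (v j)))
      ≈⟨ ∑-distrib-+ (λ j → x j ^ suc q + v j ^ suc q) _ ⟩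
    sum (λ j → x j ^ suc q + v j ^ suc q) + sum (λ j → tr (x j * conj (v j)))
      ≈⟨ +-cong (∑-distrib-+ (λ j → x j ^ suc q) _) (sym (tr-sum (λ j → x j * conj (v j)))) ⟩
    normSum x + normSum v + tr ⟨ x , v ⟩ ∎

  ⟨,⟩-+ʳ : {v w u : Vector Carrier m} (x : Vector Carrier m) →
           (∀ j → v j + w j ≈ u j) → ⟨ x , v ⟩ + ⟨ x , w ⟩ ≈ ⟨ x , u ⟩
  ⟨,⟩-+ʳ {v = v} {w} {u} x e = begin
    ⟨ x , v ⟩ + ⟨ x , w ⟩                               ≈⟨ ∑-distrib-+ (λ j → x j * conj (v j)) _ ⟨
    sum (λ j → x j * conj (v j) + x j * conj (w j))   ≈⟨ sum-cong-≋ (λ j → distribˡ (x j) _ _) ⟨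
    sum (λ j → x j * (conj (v j) + conj (w j)))
      ≈⟨ sum-cong-≋ (λ j → *-congˡ (trans (sym (conj-+ (v j) (w j))) (conj-cong (e j)))) ⟩
    ⟨ x , u ⟩                                           ∎

  -- The matrices `D` and the collineations they induce

  identityMatrix-diagonal : (i : Fin k) → identityMatrix i i ≈ 1#
  identityMatrix-diagonal i with i Fin.≟ i
  ... | yes _  = refl
  ... | no i≢i = contradiction ≡.refl i≢i

  identityMatrix-offDiagonal : (i j : Fin k) → i ≢ j → identityMatrix i j ≈ 0#
  identityMatrix-offDiagonal i j i≢j with i Fin.≟ j
  ... | yes i≡j = contradiction i≡j i≢j
  ... | no _    = refl

  ·-D : (X : Vector Carrier (suc k)) (i : Vector Carrier k) → ∀ c →
        (X · D i) c ≈ sum (λ r → X (inject₁ r) * identityMatrix (inject₁ r) c) + last X * (i ∷ʳ 1#) c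
  ·-D X i c = trans (sum-init-last (λ r → X r * D i r c)) (+-cong
    (sum-cong-≋ λ r → *-congˡ {X (inject₁ r)} (reflexive
      (≡.cong (_$ c) (init-insertAt-fromℕ (identityMatrix ∘ inject₁) (i ∷ʳ 1#) r))))
    (*-congˡ (reflexive (≡.cong (_$ c) (last-insertAt-fromℕ (identityMatrix ∘ inject₁) (i ∷ʳ 1#))))))

  init-·-D : (X : Vector Carrier (suc k)) (i : Vector Carrier k) → ∀ j →
             (X · D i) (inject₁ j) ≈ X (inject₁ j) + last X * i j
  init-·-D X i j = trans (·-D X i (inject₁ j)) (+-cong
    (trans (sum-single +-commutativeMonoid _ j λ r r≢j →
              trans (*-congˡ (identityMatrix-offDiagonal (inject₁ r) (inject₁ j) (r≢j ∘ Fin.inject₁-injective))) (zeroʳ _))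
           (trans (*-congˡ (identityMatrix-diagonal (inject₁ j))) (*-identityʳ _)))
    (*-congˡ (reflexive (init-insertAt-fromℕ i 1# j))))

  last-·-D : (X : Vector Carrier (suc k)) (i : Vector Carrier k) → last (X · D i) ≈ last X
  last-·-D {k} X i = begin
    last (X · D i)
      ≈⟨ ·-D X i (fromℕ k) ⟩
    sum (λ r → X (inject₁ r) * identityMatrix (inject₁ r) (fromℕ k)) + last X * last (i ∷ʳ 1#)
      ≈⟨ +-cong (trans (sum-cong-≋ λ r →
                   trans (*-congˡ (identityMatrix-offDiagonal (inject₁ r) (fromℕ k) (Fin.fromℕ≢inject₁ ∘ ≡.sym)))
                         (zeroʳ (X (inject₁ r))))
                   (sum-replicate-zero k))
                (trans (*-congˡ (reflexive (last-insertAt-fromℕ i 1#))) (*-identityʳ _)) ⟩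
    0# + last X                                ≈⟨ +-identityˡ _ ⟩
    last X                                     ∎

  F-affine : (Y : Vector Carrier (2 ℕ.+ m)) → last Y ≈ 1# → F Y ≈ normSum (init (init Y)) + tr (last (init Y))
  F-affine Y lastY≈1 = begin
    normSum (init (init Y)) + conj y * last Y + y * conj (last Y)
      ≈⟨ +-cong (+-congˡ (trans (*-congˡ lastY≈1) (*-identityʳ _)))
                (trans (*-congˡ (trans (conj-cong lastY≈1) conj-1)) (*-identityʳ y)) ⟩
    normSum (init (init Y)) + conj y + y    ≈⟨ +-assoc _ _ _ ⟩
    normSum (init (init Y)) + tr y          ∎
    where y = last (init Y)

  F^-affine : (i : Vector Carrier (suc m)) (X : Vector Carrier (2 ℕ.+ m)) →
              normSum (init i) + conj (last i) + last i ≈ 0# → last X ≈ 1# →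
              F^[ i ] X ≈ value (init i) (init (init X)) (last (init X))
  F^-affine i X i∈𝓡 lastX≈1 = begin
    F^[ i ] X
      ≈⟨ F-affine (X · D i) (trans (last-·-D X i) lastX≈1) ⟩
    normSum (init (init (X · D i))) + tr (last (init (X · D i)))
      ≈⟨ +-cong (normSum-cong (λ j → coordinate (inject₁ j))) (tr-cong (coordinate (fromℕ _))) ⟩
    normSum (λ j → x j + v j) + tr (y + last i)
      ≈⟨ +-cong (normSum-+ x v) (tr-+ y (last i)) ⟩
    normSum x + normSum v + tr ⟨ x , v ⟩ + (tr y + (conj (last i) + last i))
      -- All terms that involve the parameters alone are gathered at the end, where they form the
      -- left side of `equation`.
      ≈⟨ solve 6 (λ A B T U c l → (A :+ B :+ T) :+ (U :+ (c :+ l)) := (A :+ U :+ T) :+ (B :+ c :+ l))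
                 refl (normSum x) (normSum v) (tr ⟨ x , v ⟩) (tr y) (conj (last i)) (last i) ⟩
    value v x y + (normSum v + conj (last i) + last i)
      ≈⟨ trans (+-congˡ i∈𝓡) (+-identityʳ _) ⟩
    value v x y ∎
    where
    x = init (init X)
    y = last (init X)
    v = init i
    coordinate : ∀ j → (X · D i) (inject₁ j) ≈ X (inject₁ j) + i j
    coordinate j = trans (init-·-D X i j) (+-congˡ (trans (*-congʳ lastX≈1) (*-identityˡ (i j))))

  -- The image of the point (0,…,0,1) recovers the parameters of a collineation.
  SameCollineation⇒≈ᵛ : {i j : Vector Carrier k} → SameCollineation i j → i ≈ᵛ j
  SameCollineation⇒≈ᵛ {k} {i} {j} same =
    let s , s≉0 , e = Equivalence.to (same X E X≉0 E≉0) (1# , 1≉0 , λ c → sym (*-identityˡ _))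
        -- Equality of projective points leaves a scalar s open; the last coordinates, which are 1
        -- on both sides, force s = 1.
        s≈1 = begin
          s               ≈⟨ *-identityʳ s ⟨
          s * 1#          ≈⟨ *-congˡ (trans (last-·-D E i) last-E) ⟨
          s * last X      ≈⟨ e (fromℕ k) ⟨
          last (E · D j)  ≈⟨ trans (last-·-D E j) last-E ⟩
          1#              ∎
    in λ c → begin
      i c                      ≈⟨ E·D i c ⟨
      X (inject₁ c)            ≈⟨ *-identityˡ _ ⟨
      1# * X (inject₁ c)       ≈⟨ *-congʳ s≈1 ⟨
      s * X (inject₁ c)        ≈⟨ e (inject₁ c) ⟨
      (E · D j) (inject₁ c)    ≈⟨ E·D j c ⟩
      j c                      ∎
    where
    E X : Vector Carrier (suc k)
    E = replicate k 0# ∷ʳ 1#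
    X = E · D i
    last-E : last E ≈ 1#
    last-E = reflexive (last-insertAt-fromℕ (replicate k 0#) 1#)
    E≉0 : ¬ E ≈ᵛ0
    E≉0 E≈0 = 1≉0 (trans (sym last-E) (E≈0 (fromℕ k)))
    X≉0 : ¬ X ≈ᵛ0
    X≉0 X≈0 = 1≉0 (trans (sym (trans (last-·-D E i) last-E)) (X≈0 (fromℕ k)))
    E·D : ∀ i c → (E · D i) (inject₁ c) ≈ i c
    E·D i c = begin
      (E · D i) (inject₁ c)        ≈⟨ init-·-D E i c ⟩
      E (inject₁ c) + last E * i c ≈⟨ +-cong (reflexive (init-insertAt-fromℕ (replicate k 0#) 1# c)) (*-congʳ last-E) ⟩
      0# + 1# * i c                ≈⟨ trans (+-identityˡ _) (*-identityˡ _) ⟩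
      i c                          ∎

  ≈ᵛ⇒SameCollineation : {i j : Vector Carrier k} → i ≈ᵛ j → SameCollineation i j
  ≈ᵛ⇒SameCollineation {k} i≈j X X′ _ _ = mk⇔ (transfer i≈j) (transfer (sym ∘ i≈j))
    where
    transfer : ∀ {i j : Vector Carrier k} → i ≈ᵛ j → Maps i X X′ → Maps j X X′
    transfer {i} {j} i≈j (s , s≉0 , e) = s , s≉0 , λ c → trans (sym (·D-cong c)) (e c)
      where
      ·D-cong : (X′ · D i) ≈ᵛ (X′ · D j)
      ·D-cong = init-last-elim _
        (λ c → trans (init-·-D X′ i c) (trans (+-congˡ (*-congˡ (i≈j c))) (sym (init-·-D X′ j c))))
        (trans (last-·-D X′ i) (sym (last-·-D X′ j)))

  -- Counting vectors and solving one linear equation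

  vector-cardinality : ∀ k → HasCardinality (vectorSetoid k) ((q ℕ.^ 2) ℕ.^ k)
  vector-cardinality k = record
    { to        = λ v → funToFin (Card.to ∘ v)
    ; from      = λ i → Card.from ∘ finToFun i
    ; to-cong   = λ e → funToFin-cong (Card.to-cong ∘ e)
    ; from-cong = λ { ≡.refl _ → refl }
    ; inverse   = (λ {i} e → ≡.trans (funToFin-cong (λ j → Card.inverseˡ (e j))) (Fin.funToFin-finToFin {k} i))
                , (λ { {v} ≡.refl j → Card.inverseʳ (Fin.finToFun-funToFin (Card.to ∘ v) j) })
    }

  -- Together with `⟨,⟩-solve-pivot` this makes the j-th coordinate of a solution of ⟨ x , v ⟩ = s a
  -- function of the other coordinates: here uniqueness, there existence.
  ⟨,⟩-cancel-pivot : (x y v : Vector Carrier (suc m)) (j : Fin (suc m)) → ¬ v j ≈ 0# →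
                     (∀ r → x (punchIn j r) ≈ y (punchIn j r)) → ⟨ x , v ⟩ ≈ ⟨ y , v ⟩ → x j ≈ y j
  ⟨,⟩-cancel-pivot x y v j vⱼ≉0 x≈y xv≈yv = *-cancelˡ-≉0 (conj-≉0 vⱼ≉0) $
    trans (*-comm _ _) $ trans (+-cancelʳ ⟨ removeAt x j , removeAt v j ⟩ _ _ (begin
      x j * conj (v j) + ⟨ removeAt x j , removeAt v j ⟩   ≈⟨ sum-remove {i = j} (λ r → x r * conj (v r)) ⟨
      ⟨ x , v ⟩                                              ≈⟨ xv≈yv ⟩
      ⟨ y , v ⟩                                              ≈⟨ sum-remove {i = j} (λ r → y r * conj (v r)) ⟩
      y j * conj (v j) + ⟨ removeAt y j , removeAt v j ⟩   ≈⟨ +-congˡ (⟨,⟩-cong (sym ∘ x≈y) (λ _ → refl)) ⟩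
      y j * conj (v j) + ⟨ removeAt x j , removeAt v j ⟩   ∎)) (*-comm _ _)

  ⟨,⟩-solve-pivot : (v : Vector Carrier (suc m)) (j : Fin (suc m)) → ¬ v j ≈ 0# →
                    ∀ r s → ∃ λ t → ⟨ insertAt r j t , v ⟩ ≈ s
  ⟨,⟩-solve-pivot v j vⱼ≉0 r s =
    let w , v̄ⱼw≈1 = invertible (conj (v j)) (conj-≉0 vⱼ≉0)
        rest      = ⟨ r , removeAt v j ⟩
        t         = (s - rest) * w
        x         = insertAt r j t
    in t , (begin
      ⟨ x , v ⟩                                              ≈⟨ sum-remove {i = j} (λ i → x i * conj (v i)) ⟩
      x j * conj (v j) + ⟨ removeAt x j , removeAt v j ⟩
        ≈⟨ +-cong (*-congʳ (reflexive (insertAt-lookup r j t)))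
                  (⟨,⟩-cong (λ i → reflexive (insertAt-punchIn r j t i)) (λ _ → refl)) ⟩
      (s - rest) * w * conj (v j) + rest                       ≈⟨ +-congʳ (*-assoc _ _ _) ⟩
      (s - rest) * (w * conj (v j)) + rest
        ≈⟨ +-congʳ (trans (*-congˡ (trans (*-comm _ _) v̄ⱼw≈1)) (*-identityʳ _)) ⟩
      s - rest + rest                                          ≈⟨ //-rightDividesˡ rest s ⟩
      s                                                        ∎)

  -- Traces of the representatives and fibres of the trace

  module _ {a : Fin q → Carrier} (representatives : IsRepresentativeSystem a) where

    open IsRepresentativeSystem representatives

    tr-a-injective : ∀ {i j} → tr (a i) ≈ tr (a j) → i ≡ j
    tr-a-injective {i} {j} e = distinct i j (trans (tr-∸ (a i) (a j)) (x≈y⇒x-y≈0 e))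

    C-tr-injective : ∀ {x y} → C a x → C a y → tr x ≈ tr y → x ≈ y
    C-tr-injective (i , x≈aᵢ) (j , y≈aⱼ) e
      with ≡.refl ← tr-a-injective {i} {j} (trans (tr-cong (sym x≈aᵢ)) (trans e (tr-cong y≈aⱼ)))
      = trans x≈aᵢ (sym y≈aⱼ)

    -- Since q > 1 there are two different representatives, and their difference θ lies outside
    -- `T₀`. The trace of θ is in GF(q), so by GF(q)-linearity θ can be divided by it.
    trace-one : ∃ λ τ → tr τ ≈ 1#
    trace-one =
      let i , j , i≢j = >1⇒distinct (primePower⇒>1 pp)
          θ           = a i - a j
          trθ≉0       = i≢j ∘ distinct i j
          u , trθ*u≈1 = invertible (tr θ) trθ≉0
      in u * θ , trans (tr-scale (GFq-inverse trθ≉0 trθ*u≈1 (tr-∈GFq θ)) θ) (trans (*-comm _ _) trθ*u≈1)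

    τ : Carrier
    τ = proj₁ trace-one

    tr-[*τ] : ∀ {s} → GFq s → tr (s * τ) ≈ s
    tr-[*τ] s∈ = trans (tr-scale s∈ τ) (trans (*-congˡ (proj₂ trace-one)) (*-identityʳ _))

    -- Were x - y non-zero, some z would turn (x - y) z into `τ`, of trace 1, although the
    -- hypothesis makes this trace 0.
    tr-nondegenerate : ∀ {x y} → (∀ z → tr (x * z) ≈ tr (y * z)) → x ≈ y
    tr-nondegenerate {x} {y} e with x - y ≈? 0#
    ... | yes x-y≈0 = x-y≈0⇒x≈y x y x-y≈0
    ... | no  x-y≉0 = contradiction (begin
      1#                        ≈⟨ proj₂ trace-one ⟨
      tr τ                      ≈⟨ tr-cong (trans (sym (*-assoc _ _ _)) (trans (*-congʳ [x-y]d≈1) (*-identityˡ τ))) ⟨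
      tr ((x - y) * (d * τ))    ≈⟨ tr-cong (trans (distribʳ _ x (- y)) (+-congˡ (sym (-‿distribˡ-* y _)))) ⟩
      tr (x * z - y * z)        ≈⟨ tr-∸ _ _ ⟩
      tr (x * z) - tr (y * z)   ≈⟨ x≈y⇒x-y≈0 (e z) ⟩
      0#                        ∎) 1≉0
      where
      d       = proj₁ (invertible (x - y) x-y≉0)
      [x-y]d≈1 = proj₂ (invertible (x - y) x-y≉0)
      z       = d * τ

    -- The element s τ has trace s, and passing to the representative of its coset of `T₀` does not
    -- change the trace.
    tr-a-surjective : ∀ {s} → GFq s → ∃ λ i → tr (a i) ≈ s
    tr-a-surjective {s} s∈ =
      let i , sτ-aᵢ∈T₀ = covers (s * τ)
      in i , trans (sym (x-y≈0⇒x≈y _ _ (trans (sym (tr-∸ _ _)) sτ-aᵢ∈T₀))) (tr-[*τ] s∈)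

    GFq-cardinality : HasCardinality (Subset setoid GFq) q
    GFq-cardinality = record
      { to        = λ (s , s∈) → proj₁ (tr-a-surjective s∈)
      ; from      = λ i → tr (a i) , tr-∈GFq (a i)
      ; to-cong   = λ {(s , s∈)} {(t , t∈)} s≈t → tr-a-injective
                      (trans (proj₂ (tr-a-surjective s∈)) (trans s≈t (sym (proj₂ (tr-a-surjective t∈)))))
      ; from-cong = λ { ≡.refl → refl }
      ; inverse   = (λ {i} {(s , s∈)} e → tr-a-injective (trans (proj₂ (tr-a-surjective s∈)) e))
                  , (λ { {(s , s∈)} ≡.refl → proj₂ (tr-a-surjective s∈) })
      }

    -- Pigeonhole: otherwise the enumeration of the whole field would inject q² indices into the q
    -- indices of GF(q).
    outside-GFq : ∃ λ u → ¬ GFq u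
    outside-GFq =
      let i , ∉ = Fin.¬∀⟶∃¬ (q ℕ.^ 2) (GFq ∘ Card.from) (λ i → conj (Card.from i) ≈? Card.from i) λ all →
            contradiction (Fin.injective⇒≤ {f = λ i → to (Card.from i , all i)} (λ {i} {j} e →
               ≡.trans (≡.sym (Card.strictlyInverseˡ i))
              (≡.trans (Card.to-cong (HasCardinality⇒injective GFq-cardinality {Card.from i , all i} {Card.from j , all j} e))
                       (Card.strictlyInverseˡ j))))
             (ℕ.<⇒≱ (ℕ.<-≤-trans (ℕ.m<m*n q q {{primePower⇒nonZero pp}} (primePower⇒>1 pp))
                                 (ℕ.≤-reflexive (≡.cong (q ℕ.*_) (≡.sym (ℕ.*-identityʳ q))))))
      in Card.from i , ∉
      where open Inverse GFq-cardinality using (to)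

    -- For u outside GF(q), u^q - u is non-zero and conjugation changes its sign. This yields a
    -- generator of `T₀` over GF(q) in even and odd characteristic alike.
    δ : Carrier
    δ = conj (proj₁ outside-GFq) - proj₁ outside-GFq

    δ≉0 : ¬ δ ≈ 0#
    δ≉0 = proj₂ outside-GFq ∘ x-y≈0⇒x≈y _ _

    δ∈T₀ : T₀ δ
    δ∈T₀ = let u = proj₁ outside-GFq in begin
      tr (conj u - u)          ≈⟨ tr-∸ (conj u) u ⟩
      conj (conj u) + conj u - (conj u + u)  ≈⟨ +-congʳ (trans (+-congʳ (conj-conj u)) (+-comm _ _)) ⟩
      conj u + u - (conj u + u)  ≈⟨ -‿inverseʳ _ ⟩
      0#                       ∎

    -- Conjugation negates both z and `δ`, hence fixes their quotient.
    T₀-multiple : ∀ {z} → T₀ z → ∃ λ s → GFq s × z ≈ δ * s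
    T₀-multiple {z} z∈ =
      let d , δd≈1 = invertible δ δ≉0
          s        = d * z
          z≈δs     = trans (sym (trans (*-congʳ δd≈1) (*-identityˡ z))) (*-assoc δ d z)
      in s , *-cancelˡ-≉0 (conj-≉0 δ≉0) (begin
          conj δ * conj s    ≈⟨ conj-* δ s ⟨
          conj (δ * s)       ≈⟨ conj-cong z≈δs ⟨
          conj z             ≈⟨ inverseˡ-unique _ _ z∈ ⟩
          - z                ≈⟨ -‿cong z≈δs ⟩
          - (δ * s)          ≈⟨ -‿distribˡ-* δ s ⟩
          - δ * s            ≈⟨ *-congʳ (inverseˡ-unique _ _ δ∈T₀) ⟨
          conj δ * s         ∎) , z≈δs

    -- As T₀ = δ GF(q), the elements of trace s are s τ + δ t for t in GF(q).
    fibre : Carrier → Fin q → Carrier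
    fibre s i = s * τ + δ * tr (a i)

    tr-fibre : ∀ {s} → GFq s → ∀ i → tr (fibre s i) ≈ s
    tr-fibre {s} s∈ i = begin
      tr (s * τ + δ * tr (a i))         ≈⟨ tr-+ _ _ ⟩
      tr (s * τ) + tr (δ * tr (a i))
        ≈⟨ +-cong (tr-[*τ] s∈) (trans (tr-cong (*-comm _ _)) (trans (tr-scale (tr-∈GFq (a i)) δ) (*-congˡ δ∈T₀))) ⟩
      s + tr (a i) * 0#                 ≈⟨ +-congˡ (zeroʳ _) ⟩
      s + 0#                            ≈⟨ +-identityʳ s ⟩
      s                                 ∎

    fibre-injective : ∀ s {i j} → fibre s i ≈ fibre s j → i ≡ j
    fibre-injective s = tr-a-injective ∘ *-cancelˡ-≉0 δ≉0 ∘ +-cancelˡ (s * τ) _ _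

    fibre-surjective : ∀ {s} → GFq s → ∀ {z} → tr z ≈ s → ∃ λ i → fibre s i ≈ z
    fibre-surjective {s} s∈ {z} trz≈s =
      let t , t∈ , z-sτ≈δt = T₀-multiple {z - s * τ}
            (trans (tr-∸ z (s * τ)) (trans (+-cong trz≈s (-‿cong (tr-[*τ] s∈))) (-‿inverseʳ s)))
          i , traᵢ≈t = tr-a-surjective t∈
      in i , (begin
        s * τ + δ * tr (a i)   ≈⟨ +-congˡ (trans (*-congˡ traᵢ≈t) (sym z-sτ≈δt)) ⟩
        s * τ + (z - s * τ)    ≈⟨ +-comm _ _ ⟩
        z - s * τ + s * τ      ≈⟨ //-rightDividesˡ (s * τ) z ⟩
        z                      ∎)

    -- Points of an affine trace hyperplane

    hyperplane-cardinality : (d : Vector Carrier (suc m)) (j : Fin (suc m)) → ¬ d j ≈ 0# → ∀ {s} → GFq s →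
                             HasCardinality (Subset (vectorSetoid (suc m)) λ x → tr ⟨ x , d ⟩ ≈ s)
                                            ((q ℕ.^ 2) ℕ.^ m ℕ.* q)
    hyperplane-cardinality {m} d j dⱼ≉0 {s} s∈ =
      HasCardinality-resp-bijective (×-cardinality (vector-cardinality m) (Identity.inverse _))
        point point-cong point-injective point-surjective
      where
      H : Setoid _ _
      H = Subset (vectorSetoid (suc m)) λ x → tr ⟨ x , d ⟩ ≈ s

      pivot : ∀ r i → ∃ λ t → ⟨ insertAt r j t , d ⟩ ≈ fibre s i
      pivot r i = ⟨,⟩-solve-pivot d j dⱼ≉0 r (fibre s i)

      vector : Vector Carrier m → Fin q → Vector Carrier (suc m)
      vector r i = insertAt r j (proj₁ (pivot r i))

      point : Vector Carrier m × Fin q → Setoid.Carrier H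
      point (r , i) = vector r i , trans (tr-cong (proj₂ (pivot r i))) (tr-fibre s∈ i)

      vector-punchIn : ∀ r i c → vector r i (punchIn j c) ≈ r c
      vector-punchIn r i c = reflexive (insertAt-punchIn r j (proj₁ (pivot r i)) c)

      -- `pivot` returns a witness without a proof that it respects equality of r. Uniqueness of the
      -- solution supplies that proof for `point-cong` and also gives surjectivity.
      vector-unique : ∀ {r i x} → (∀ c → r c ≈ x (punchIn j c)) → fibre s i ≈ ⟨ x , d ⟩ → vector r i ≈ᵛ x
      vector-unique {r} {i} {x} r≈x fᵢ≈⟨x,d⟩ = punchIn-elim _ j
        (⟨,⟩-cancel-pivot (vector r i) x d j dⱼ≉0 away (trans (proj₂ (pivot r i)) fᵢ≈⟨x,d⟩)) away
        where
        away : ∀ c → vector r i (punchIn j c) ≈ x (punchIn j c)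
        away c = trans (vector-punchIn r i c) (r≈x c)

      point-cong : ∀ {u v} → Setoid._≈_ (×-setoid (vectorSetoid m) (≡.setoid (Fin q))) u v →
                   proj₁ (point u) ≈ᵛ proj₁ (point v)
      point-cong {r , i} {r′ , _} (r≈r′ , ≡.refl) =
        vector-unique (λ c → trans (r≈r′ c) (sym (vector-punchIn r′ i c))) (sym (proj₂ (pivot r′ i)))

      point-injective : ∀ {u v} → proj₁ (point u) ≈ᵛ proj₁ (point v) →
                        Setoid._≈_ (×-setoid (vectorSetoid m) (≡.setoid (Fin q))) u v
      point-injective {r , i} {r′ , i′} e =
        (λ c → trans (sym (vector-punchIn r i c)) (trans (e (punchIn j c)) (vector-punchIn r′ i′ c))) ,
        fibre-injective s (trans (sym (proj₂ (pivot r i)))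
                          (trans (⟨,⟩-cong {v = d} {d} e (λ _ → refl)) (proj₂ (pivot r′ i′))))

      point-surjective : ∀ x → ∃ λ u → proj₁ (point u) ≈ᵛ proj₁ x
      point-surjective (x , tr⟨x,d⟩≈s) =
        let i , fᵢ≈⟨x,d⟩ = fibre-surjective s∈ tr⟨x,d⟩≈s
        in (removeAt x j , i) , vector-unique (λ _ → refl) fᵢ≈⟨x,d⟩

    -- Rows and columns in coordinates

    value-solve : (v x : Vector Carrier m) → ∀ {s} → GFq s → ∃ λ i → value v x (a i) ≈ s
    value-solve v x {s} s∈ =
      let N = normSum x
          T = tr ⟨ x , v ⟩
          i , traᵢ≈ = tr-a-surjective (GFq-+ s∈ (GFq-neg (GFq-+ (GFq-normSum x) (tr-∈GFq ⟨ x , v ⟩))))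
      in i , (begin
        N + tr (a i) + T       ≈⟨ solve 3 (λ n t u → n :+ t :+ u := t :+ (n :+ u)) refl N (tr (a i)) T ⟩
        tr (a i) + (N + T)     ≈⟨ +-congʳ traᵢ≈ ⟩
        s - (N + T) + (N + T)  ≈⟨ //-rightDividesˡ (N + T) s ⟩
        s                      ∎)

    value-injective : (v : Vector Carrier m) {x x′ : Vector Carrier m} {y y′ : Carrier} → C a y → C a y′ →
                      x ≈ᵛ x′ → value v x y ≈ value v x′ y′ → y ≈ y′
    value-injective v {x} {x′} {y} {y′} y∈C y′∈C x≈x′ e = C-tr-injective y∈C y′∈C
      (+-cancelˡ (normSum x) _ _ (+-cancelʳ (tr ⟨ x , v ⟩) _ _
        (trans e (value-cong {y = y′} (λ _ → refl) (sym ∘ x≈x′) refl))))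

    parameter : Vector Carrier m → Setoid.Carrier (𝓡 a m)
    parameter v =
      let i , traᵢ≈ = tr-a-surjective (GFq-neg (GFq-normSum v))
          last≈     = reflexive (last-insertAt-fromℕ v (a i))
      in v ∷ʳ a i , record
        { last∈C   = i , last≈
        ; equation = begin
            normSum (init (v ∷ʳ a i)) + conj (last (v ∷ʳ a i)) + last (v ∷ʳ a i)   ≈⟨ +-assoc _ _ _ ⟩
            normSum (init (v ∷ʳ a i)) + tr (last (v ∷ʳ a i))
              ≈⟨ +-cong (normSum-cong (λ j → reflexive (init-insertAt-fromℕ v (a i) j))) (trans (tr-cong last≈) traᵢ≈) ⟩
            normSum v - normSum v                                                  ≈⟨ -‿inverseʳ _ ⟩
            0#                                                                     ∎
        }

    coefficients : Setoid.Carrier (𝓡 a m) → Vector Carrier m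
    coefficients (i , _) = init i

    coefficients-parameter : (v : Vector Carrier m) → coefficients (parameter v) ≈ᵛ v
    coefficients-parameter v j = reflexive (init-insertAt-fromℕ v _ j)

    coefficients-cong : {g h : Setoid.Carrier (𝓡 a m)} →
                        Setoid._≈_ (𝓡 a m) g h → coefficients g ≈ᵛ coefficients h
    coefficients-cong g≈h = SameCollineation⇒≈ᵛ g≈h ∘ inject₁

    -- The last parameter is forced by the others: its trace is minus their norm sum, and the trace
    -- is injective on `C`. Rows can thus be counted as vectors of length n - 1.
    coefficients-injective : {g h : Setoid.Carrier (𝓡 a m)} →
                             coefficients g ≈ᵛ coefficients h → Setoid._≈_ (𝓡 a m) g h
    coefficients-injective {g = i , i∈} {j , j∈} e = ≈ᵛ⇒SameCollineation (init-last-elim _ e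
      (C-tr-injective (IsParameter.last∈C i∈) (IsParameter.last∈C j∈) (begin
        tr (last i)            ≈⟨ tr-last i i∈ ⟩
        - normSum (init i)     ≈⟨ -‿cong (normSum-cong e) ⟩
        - normSum (init j)     ≈⟨ tr-last j j∈ ⟨
        tr (last j)            ∎)))
      where
      tr-last : ∀ i → IsParameter a i → tr (last i) ≈ - normSum (init i)
      tr-last i i∈ = inverseʳ-unique _ _ (trans (sym (+-assoc _ _ _)) (IsParameter.equation i∈))

    rows-cardinality : ∀ m → HasCardinality (𝓡 a m) ((q ℕ.^ 2) ℕ.^ m)
    rows-cardinality m = HasCardinality-resp-bijective (vector-cardinality m) parameter
      (λ {v} {w} e → coefficients-injective {g = parameter v} {parameter w} λ j →
        trans (coefficients-parameter v j) (trans (e j) (sym (coefficients-parameter w j))))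
      (λ {v} {w} e j → trans (sym (coefficients-parameter v j))
        (trans (coefficients-cong {g = parameter v} {parameter w} e j) (coefficients-parameter w j)))
      (λ g → coefficients g ,
        coefficients-injective {g = parameter (coefficients g)} {g} (coefficients-parameter (coefficients g)))

    column : Vector Carrier m → Fin q → Setoid.Carrier (𝓦₀ a m)
    column x i = (x ∷ʳ a i) ∷ʳ 1# , reflexive (last-insertAt-fromℕ (x ∷ʳ a i) 1#) , i ,
      reflexive (≡.trans (init-insertAt-fromℕ (x ∷ʳ a i) 1# (fromℕ _)) (last-insertAt-fromℕ x (a i)))

    initial : Setoid.Carrier (𝓦₀ a m) → Vector Carrier m
    initial (X , _) = init (init X)

    middle : Setoid.Carrier (𝓦₀ a m) → Carrier
    middle (X , _) = last (init X)

    middle∈C : (X : Setoid.Carrier (𝓦₀ a m)) → C a (middle X)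
    middle∈C (_ , _ , ∈C) = ∈C

    initial-column : (x : Vector Carrier m) → ∀ i → initial (column x i) ≈ᵛ x
    initial-column x i j =
      reflexive (≡.trans (init-insertAt-fromℕ (x ∷ʳ a i) 1# (inject₁ j)) (init-insertAt-fromℕ x (a i) j))

    middle-column : (x : Vector Carrier m) → ∀ i → middle (column x i) ≈ a i
    middle-column x i = proj₂ (middle∈C (column x i))

    𝓦₀-ext : {X Y : Setoid.Carrier (𝓦₀ a m)} →
             initial X ≈ᵛ initial Y → middle X ≈ middle Y → Setoid._≈_ (𝓦₀ a m) X Y
    𝓦₀-ext {X = _ , lastX≈1 , _} {_ , lastY≈1 , _} e f =
      init-last-elim _ (init-last-elim _ e f) (trans lastX≈1 (sym lastY≈1))

    columns-cardinality : ∀ m → HasCardinality (𝓦₀ a m) ((q ℕ.^ 2) ℕ.^ m ℕ.* q)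
    columns-cardinality m = HasCardinality-resp-bijective
      (×-cardinality (vector-cardinality m) (Identity.inverse _)) (λ (x , i) → column x i)
      (λ { {x , i} {x′ , _} (e , ≡.refl) → 𝓦₀-ext {X = column x i} {column x′ i}
             (λ j → trans (initial-column x i j) (trans (e j) (sym (initial-column x′ i j))))
             (trans (middle-column x i) (sym (middle-column x′ i))) })
      (λ { {x , i} {x′ , i′} e →
             (λ j → trans (sym (initial-column x i j)) (trans (e (inject₁ (inject₁ j))) (initial-column x′ i′ j)))
           , tr-a-injective (tr-cong (trans (sym (middle-column x i))
               (trans (e (inject₁ (fromℕ m))) (middle-column x′ i′)))) })
      (λ X → let i , y≈aᵢ = middle∈C X in (initial X , i) ,
        𝓦₀-ext {X = column (initial X) i} {X} (initial-column (initial X) i)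
               (trans (middle-column (initial X) i) (sym y≈aᵢ)))

    𝓐₀-value : (g : Setoid.Carrier (𝓡 a m)) (X : Setoid.Carrier (𝓦₀ a m)) →
               𝓐₀ a m g X ≈ value (coefficients g) (initial X) (middle X)
    𝓐₀-value (i , i∈𝓡) (X , lastX≈1 , _) = F^-affine i X (IsParameter.equation i∈𝓡) lastX≈1

    𝓐₀-column : (g : Setoid.Carrier (𝓡 a m)) (x : Vector Carrier m) → ∀ i →
                𝓐₀ a m g (column x i) ≈ value (coefficients g) x (a i)
    𝓐₀-column g x i = trans (𝓐₀-value g (column x i))
      (value-cong (λ _ → refl) (initial-column x i) (middle-column x i))

    -- Columns with two prescribed entries

    module _ (g h : Setoid.Carrier (𝓡 a (suc m))) (j : Fin (suc m))
             (gⱼ≉hⱼ : ¬ coefficients g j ≈ coefficients h j)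
             {s t : Carrier} (s∈ : GFq s) (t∈ : GFq t) where

      private
        d : Vector Carrier (suc m)
        d r = coefficients g r - coefficients h r

        value-difference : ∀ x y → value (coefficients h) x y + tr ⟨ x , d ⟩ ≈ value (coefficients g) x y
        value-difference x y = trans (+-assoc _ _ _) $ +-congˡ $ trans (sym (tr-+ _ _)) $
          tr-cong (⟨,⟩-+ʳ x λ r → trans (+-comm _ _) (//-rightDividesˡ (coefficients h r) (coefficients g r)))

        H : Setoid _ _
        H = Subset (vectorSetoid (suc m)) λ x → tr ⟨ x , d ⟩ ≈ s - t

        Solutions : Setoid _ _
        Solutions = Subset (𝓦₀ a (suc m)) λ X → 𝓐₀ a (suc m) g X ≈ s × 𝓐₀ a (suc m) h X ≈ t

      solutions-cardinality : HasCardinality Solutions ((q ℕ.^ 2) ℕ.^ m ℕ.* q)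
      solutions-cardinality = HasCardinality-resp-bijective
        (hyperplane-cardinality d j (gⱼ≉hⱼ ∘ x-y≈0⇒x≈y _ _) (GFq-+ s∈ (GFq-neg t∈)))
        solution
        (λ {x} {x′} x≈x′ → solution-unique x (solution x′)
          (λ r → trans (x≈x′ r) (sym (initial-column (proj₁ x′) (index-of (proj₁ x′)) r))))
        (λ { {x , _} {x′ , _} e r → trans (sym (initial-column x (index-of x) r))
               (trans (e (inject₁ (inject₁ r))) (initial-column x′ (index-of x′) r)) })
        (λ X → (initial (proj₁ X) , initial∈H X) ,
               solution-unique (initial (proj₁ X) , initial∈H X) X (λ _ → refl))
        where
        index-of : Vector Carrier (suc m) → Fin q
        index-of x = proj₁ (value-solve (coefficients g) x s∈)

        value-index-of : ∀ x → value (coefficients g) x (a (index-of x)) ≈ s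
        value-index-of x = proj₂ (value-solve (coefficients g) x s∈)

        solution : Setoid.Carrier H → Setoid.Carrier Solutions
        solution (x , x∈H) =
          column x i ,
          trans (𝓐₀-column g x i) (value-index-of x) ,
          -- The n-th coordinate was chosen to suit row g; membership of x in `H` carries the
          -- prescribed value over to row h.
          trans (𝓐₀-column h x i) (+-cancelʳ (s - t) _ _ (begin
            value (coefficients h) x (a i) + (s - t)           ≈⟨ +-congˡ x∈H ⟨
            value (coefficients h) x (a i) + tr ⟨ x , d ⟩      ≈⟨ value-difference x (a i) ⟩
            value (coefficients g) x (a i)                     ≈⟨ value-index-of x ⟩
            s                                                  ≈⟨ //-rightDividesˡ t s ⟨
            s - t + t                                          ≈⟨ +-comm _ _ ⟩
            t + (s - t)                                        ∎))
          where i = index-of x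

        initial∈H : ∀ X → tr ⟨ initial (proj₁ X) , d ⟩ ≈ s - t
        initial∈H (X , gX≈s , hX≈t) = +-cancelˡ t _ _ (begin
          t + tr ⟨ initial X , d ⟩   ≈⟨ +-congʳ (trans (sym hX≈t) (𝓐₀-value h X)) ⟩
          value (coefficients h) (initial X) (middle X) + tr ⟨ initial X , d ⟩
                                     ≈⟨ value-difference (initial X) (middle X) ⟩
          value (coefficients g) (initial X) (middle X)
                                     ≈⟨ trans (sym (𝓐₀-value g X)) gX≈s ⟩
          s                          ≈⟨ //-rightDividesˡ t s ⟨
          s - t + t                  ≈⟨ +-comm _ _ ⟩
          t + (s - t)                ∎)

        -- Row g determines the n-th coordinate within `C`, so a solution is known from its first n
        -- - 1 coordinates. Both congruence and surjectivity of `solution` follow.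
        solution-unique : (x : Setoid.Carrier H) (X : Setoid.Carrier Solutions) → proj₁ x ≈ᵛ initial (proj₁ X) →
                          Setoid._≈_ Solutions (solution x) X
        solution-unique (x , x∈H) (X , gX≈s , _) x≈X = 𝓦₀-ext {X = column x i} {X}
          (λ r → trans (initial-column x i r) (x≈X r))
          (value-injective (coefficients g) (middle∈C (column x i)) (middle∈C X)
            (λ r → trans (initial-column x i r) (x≈X r)) (begin
              value (coefficients g) (initial (column x i)) (middle (column x i))  ≈⟨ 𝓐₀-value g (column x i) ⟨
              𝓐₀ a (suc m) g (column x i)   ≈⟨ trans (𝓐₀-column g x i) (value-index-of x) ⟩
              s                             ≈⟨ gX≈s ⟨
              𝓐₀ a (suc m) g X              ≈⟨ 𝓐₀-value g X ⟩
              value (coefficients g) (initial X) (middle X) ∎))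
          where i = index-of x

    -- Strength and simplicity of the array

    private
      instance
        q≢0 : NonZero q
        q≢0 = primePower⇒nonZero pp

    𝓐₀-strength : ∀ m (g : Fin 2 → Setoid.Carrier (𝓡 a m)) → Injective _≡_ (Setoid._≈_ (𝓡 a m)) g →
                  (b : Fin 2 → Carrier) → (∀ i → GFq (b i)) →
                  ∃ λ μ → HasCardinality (Subset (𝓦₀ a m) λ X → ∀ i → 𝓐₀ a m (g i) X ≈ b i) μ
                        × + μ / 1 ≡ index (q ℕ.^ (2 ℕ.* suc m ∸ 1)) q 2
    𝓐₀-strength m g g-injective b b∈ = go m g pivot
      where
      -- Rows that agree in every coefficient are the same collineation, and injectivity of the
      -- family would then identify 0 and 1 in `Fin 2`. Decidable equality turns this into an
      -- explicit index j.
      pivot : ∃ λ j → ¬ coefficients (g zero) j ≈ coefficients (g (suc zero)) j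
      pivot = Fin.¬∀⟶∃¬ m _ (λ j → coefficients (g zero) j ≈? coefficients (g (suc zero)) j) λ e →
        contradiction (g-injective (coefficients-injective {g = g zero} {g (suc zero)} e)) λ ()

      go : ∀ m (g : Fin 2 → Setoid.Carrier (𝓡 a m)) →
           (∃ λ j → ¬ coefficients (g zero) j ≈ coefficients (g (suc zero)) j) →
           ∃ λ μ → HasCardinality (Subset (𝓦₀ a m) λ X → ∀ i → 𝓐₀ a m (g i) X ≈ b i) μ
                 × + μ / 1 ≡ index (q ℕ.^ (2 ℕ.* suc m ∸ 1)) q 2
      -- The case n = 1 is absent because its pivot would be an element of `Fin 0`.
      go (suc m) g (j , g₀≉g₁) = _ ,
        HasCardinality-resp-bijective
          (solutions-cardinality (g zero) (g (suc zero)) j g₀≉g₁ (b∈ zero) (b∈ (suc zero)))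
          (λ (X , e , f) → X , λ { zero → e ; (suc zero) → f })
          id id
          (λ (X , e) → (X , e zero , e (suc zero)) , λ _ → refl) ,
        index-column q m

    𝓐₀-isOrthogonalArray : ∀ m → IsOrthogonalArray (𝓡 a m) (𝓦₀ a m) setoid GFq (𝓐₀ a m)
                                   (q ℕ.^ (2 ℕ.* suc m ∸ 1)) (q ℕ.^ (2 ℕ.* suc m ∸ 2)) q 2
    𝓐₀-isOrthogonalArray m = record
      { cong     = λ {g} {h} {X} {Y} g≈h X≈Y → begin
          𝓐₀ a m g X                                      ≈⟨ 𝓐₀-value g X ⟩
          value (coefficients g) (initial X) (middle X)
            ≈⟨ value-cong (coefficients-cong {g = g} {h} g≈h) (λ j → X≈Y (inject₁ (inject₁ j)))
                           (X≈Y (inject₁ (fromℕ m))) ⟩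
          value (coefficients h) (initial Y) (middle Y)   ≈⟨ 𝓐₀-value h Y ⟨
          𝓐₀ a m h Y                                      ∎
      ; columns  = ≡.subst (HasCardinality (𝓦₀ a m)) (≡.sym (^[2*suc∸1] q m)) (columns-cardinality m)
      ; rows     = ≡.subst (HasCardinality (𝓡 a m)) (≡.sym (^[2*suc∸2] q m)) (rows-cardinality m)
      ; levels   = GFq-cardinality
      ; entries  = λ g X → GFq-resp (sym (𝓐₀-value g X)) (GFq-value (coefficients g) (initial X) (middle X))
      ; strength = 𝓐₀-strength m
      }

    -- Every vector v is the coefficient vector of some row. Comparison with the row of coefficients
    -- 0 removes the part common to all rows and leaves tr ⟨ x , v ⟩ for all v, which determines x;
    -- the row of coefficients 0 then fixes the n-th coordinate.
    𝓐₀-isSimple : ∀ m → IsSimple (𝓡 a m) (𝓦₀ a m) setoid (𝓐₀ a m)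
    𝓐₀-isSimple m X Y X≈Y = 𝓦₀-ext {X = X} {Y} x≈x′
      (value-injective (replicate m 0#) (middle∈C X) (middle∈C Y) x≈x′ (values≈ (replicate m 0#)))
      where
      x  = initial X
      x′ = initial Y
      y  = middle X
      y′ = middle Y

      values≈ : ∀ v → value v x y ≈ value v x′ y′
      values≈ v = begin
        value v x y            ≈⟨ value-cong {y = y} (coefficients-parameter v) (λ _ → refl) refl ⟨
        value (coefficients (parameter v)) x y   ≈⟨ 𝓐₀-value (parameter v) X ⟨
        𝓐₀ a m (parameter v) X ≈⟨ X≈Y (parameter v) ⟩
        𝓐₀ a m (parameter v) Y ≈⟨ 𝓐₀-value (parameter v) Y ⟩
        value (coefficients (parameter v)) x′ y′ ≈⟨ value-cong {y = y′} (coefficients-parameter v) (λ _ → refl) refl ⟩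
        value v x′ y′          ∎

      value-0 : ∀ x y → value (replicate m 0#) x y ≈ normSum x + tr y
      value-0 x y = trans (+-congˡ (trans (tr-cong ⟨x,0⟩≈0) tr-0)) (+-identityʳ _)
        where
        ⟨x,0⟩≈0 : ⟨ x , replicate m 0# ⟩ ≈ 0#
        ⟨x,0⟩≈0 = trans (sum-cong-≋ (λ j → trans (*-congˡ conj-0) (zeroʳ (x j)))) (sum-replicate-zero m)

      tr⟨,⟩≈ : ∀ v → tr ⟨ x , v ⟩ ≈ tr ⟨ x′ , v ⟩
      tr⟨,⟩≈ v = +-cancelˡ (normSum x + tr y) _ _ (trans (values≈ v) (+-congʳ
        (trans (sym (value-0 x′ y′)) (trans (sym (values≈ (replicate m 0#))) (value-0 x y)))))

      -- The test vector carries the conjugate of z because the form conjugates its second argument;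
      -- what remains is the product x j * z that `tr-nondegenerate` expects.
      ⟨,⟩-unit : ∀ (x : Vector Carrier m) j z → ⟨ x , (λ r → identityMatrix r j * conj z) ⟩ ≈ x j * z
      ⟨,⟩-unit x j z = trans
        (sum-single +-commutativeMonoid _ j λ r r≢j → trans (*-congˡ (trans
          (conj-cong (trans (*-congʳ (identityMatrix-offDiagonal r j r≢j)) (zeroˡ _))) conj-0)) (zeroʳ (x r)))
        (*-congˡ (trans (conj-cong (trans (*-congʳ (identityMatrix-diagonal j)) (*-identityˡ _))) (conj-conj z)))

      x≈x′ : x ≈ᵛ x′
      x≈x′ j = tr-nondegenerate λ z →
        trans (tr-cong (sym (⟨,⟩-unit x j z)))
        (trans (tr⟨,⟩≈ (λ r → identityMatrix r j * conj z)) (tr-cong (⟨,⟩-unit x′ j z)))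

open import Data.Nat.Base using (_*_; _^_)

theorem3p3 : ∀ {c ℓ : Level} (q : ℕ) (pp : IsPrimePower q)
             (GFq² : FiniteField c ℓ (q ^ 2)) →
             let open Hermitian q GFq² in
             (a : Fin q → FiniteField.Carrier GFq²) → IsRepresentativeSystem a →
             (m : ℕ) →
             let n = suc m
                 instance _ = primePower⇒nonZero pp in
             IsOrthogonalArray (𝓡 a m) (𝓦₀ a m) (FiniteField.setoid GFq²) GFq (𝓐₀ a m)
               (q ^ (2 * n ∸ 1)) (q ^ (2 * n ∸ 2)) q 2
             × IsSimple (𝓡 a m) (𝓦₀ a m) (FiniteField.setoid GFq²) (𝓐₀ a m)
             × index (q ^ (2 * n ∸ 1)) q 2 ≡ q ^ᶻ (+ (2 * n) ℤ.- + 3)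
theorem3p3 q pp GFq² a representatives m =
  𝓐₀-isOrthogonalArray representatives m ,
  𝓐₀-isSimple representatives m ,
  index-^ᶻ q m {{primePower⇒nonZero pp}}
  where open HermitianProperties q pp GFq²
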